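{- Let $k\geq 1$ be an integer and let $F_k=2^{2^k}+1$. For any positive integer $n$, the only solution in positive integers $(x,y,z)$ of the Diophantine equation $$((F_k-2)n)^{x}+(2^{2^{k-1}+1}n)^{y}=(F_kn)^{z}$$ is $(x,y,z)=(2,2,2)$.
   Context: For an integer $k\geq 1$, $F_k=2^{2^k}+1$ denotes the $k$-th Fermat number. The exponent in $2^{2^{k-1}+1}$ is $2^{k-1}+1$, i.e. $2^{2^{k-1}+1}=2\cdot 2^{2^{k-1}}$. -}

module Defs where

open import Data.Nat using (ℕ; _+_; _^_)

fermat : ℕ → ℕ
fermat k = 2 ^ (2 ^ k) + 1

{-# OPTIONS --safe #-}
module Submission where

-- With q = 2 ^ 2 ^ (k − 1) the triple is (a, b, c) = (q² − 1, 2q, q² + 1), and f = q + 1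
-- divides a.  If n = 1, congruences make x and z even, and factoring c ^ z − a ^ x settles
-- the equation.  If x, y ≤ z, sizes suffice.  Otherwise n > 1, and we cancel the common power of n.
--   z < min(x, y), x ≠ y:  a factor common to n and c leaves c too small.
--   z = x < y, z = y < x, x = y > z:  lifting the exponent contradicts size.
--   y < z < x:  n is a power of 2 and c ^ z = 1 + a ^ x N, so 2 ^ z ≡ 1 (mod f) makes z
--     even, and f ^ x divides c ^ (z / 2) ± 1, which is too small.
--   x < z < y:  r ^ x + b ^ y N = c ^ z with r ∣ a, and r = 1 if x is odd.  For z even,
--     c ^ z − r ^ x is a difference of two squares with too large a power of 2.  For z odd,
--     n shares a factor e with a Fermat number 2 ^ 2 ^ i + 1 dividing a, and
--     (r ^ x) ^ 2 ^ i ≡ −1 (mod e).  Hence r ≠ 1, 2-adic lifting gives q ∣ x, and then the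
--     order of r ^ (x / q) modulo e exceeds e.

-- The congruences behind all cases are c ≡ 2 modulo any divisor of a; a ≡ -1, c ≡ 1 and, for y ≥ 2,
-- b ^ y ≡ 0 modulo q²; and b ≡ -2 modulo f. The obstacle for n > 1 is that n is arbitrary:
-- cancelling its common power leaves a cofactor about which the order of x, y, z must supply all
-- information. The case x < z < y is the hardest because n ^ (z - x) ∣ a ^ x says only that n is
-- built from factors of a. Fermat numbers enter there because a = F_k - 2 is the product F_0 ⋯
-- F_(k-1): whatever n is, it meets one of these factors, modulo which a power of 2 is -1. No
-- factorisation into primes is used beyond splitting off powers of 2. Gcds take the place of
-- primes, and lifting the exponent is stated for a divisor d of a power of w instead of for
-- valuations.

-- Congruences, coprimality and powers of 2.

module Congruence where
  open import Data.Nat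
  open import Data.Nat.Properties
  open import Data.Nat.Divisibility
  open import Data.Nat.Coprimality using (Coprime; coprime-divisor) renaming (sym to coprime-sym)
  open import Data.Nat.GCD using (gcd; gcd-greatest)
  open import Data.Nat.Tactic.RingSolver using (solve)
  open import Data.Nat.Induction using (<-rec)
  open import Data.List using (_∷_; [])
  open import Data.Product using (∃; ∃₂; _,_)
  open import Data.Sum using (_⊎_; inj₁; inj₂)
  open import Relation.Nullary using (¬_; yes; no; contradiction)
  open import Relation.Binary.PropositionalEquality

  -- Congruence without subtraction: −1 appears as the solution of x + 1 ≈ 0.
  infix 4 _≈_[mod_]
  record _≈_[mod_] (x y d : ℕ) : Set where
    constructor cong-by
    field
      i j : ℕ
      balance : x + i * d ≡ y + j * d

  private variable
    d e m n u v x y z : ℕ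

  ≈-reflexive : x ≡ y → x ≈ y [mod d ]
  ≈-reflexive refl = cong-by 0 0 refl

  ≈-refl : x ≈ x [mod d ]
  ≈-refl = ≈-reflexive refl

  ≈-sym : x ≈ y [mod d ] → y ≈ x [mod d ]
  ≈-sym (cong-by i j eq) = cong-by j i (sym eq)

  ≈-trans : x ≈ y [mod d ] → y ≈ z [mod d ] → x ≈ z [mod d ]
  ≈-trans {x} {y} {d} {z} (cong-by i j eq) (cong-by k l eq′) = cong-by (i + k) (l + j) (begin
    x + (i + k) * d   ≡⟨ solve (x ∷ i ∷ k ∷ d ∷ []) ⟩
    x + i * d + k * d ≡⟨ cong (_+ k * d) eq ⟩
    y + j * d + k * d ≡⟨ solve (y ∷ j ∷ k ∷ d ∷ []) ⟩
    y + k * d + j * d ≡⟨ cong (_+ j * d) eq′ ⟩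
    z + l * d + j * d ≡⟨ solve (z ∷ l ∷ j ∷ d ∷ []) ⟩
    z + (l + j) * d   ∎)
    where open ≡-Reasoning

  ≈-+ : x ≈ y [mod d ] → u ≈ v [mod d ] → x + u ≈ y + v [mod d ]
  ≈-+ {x} {y} {d} {u} {v} (cong-by i j eq) (cong-by k l eq′) = cong-by (i + k) (j + l) (begin
    x + u + (i + k) * d       ≡⟨ solve (x ∷ u ∷ i ∷ k ∷ d ∷ []) ⟩
    (x + i * d) + (u + k * d) ≡⟨ cong₂ _+_ eq eq′ ⟩
    (y + j * d) + (v + l * d) ≡⟨ solve (y ∷ v ∷ j ∷ l ∷ d ∷ []) ⟩
    y + v + (j + l) * d       ∎)
    where open ≡-Reasoning

  ≈-* : x ≈ y [mod d ] → u ≈ v [mod d ] → x * u ≈ y * v [mod d ]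
  ≈-* {x} {y} {d} {u} {v} (cong-by i j eq) (cong-by k l eq′) =
    cong-by (i * u + x * k + i * k * d) (j * v + y * l + j * l * d) (begin
    x * u + (i * u + x * k + i * k * d) * d ≡⟨ solve (x ∷ u ∷ i ∷ k ∷ d ∷ []) ⟩
    (x + i * d) * (u + k * d)               ≡⟨ cong₂ _*_ eq eq′ ⟩
    (y + j * d) * (v + l * d)               ≡⟨ solve (y ∷ v ∷ j ∷ l ∷ d ∷ []) ⟩
    y * v + (j * v + y * l + j * l * d) * d ∎)
    where open ≡-Reasoning

  ≈-^ : ∀ n → x ≈ y [mod d ] → x ^ n ≈ y ^ n [mod d ]
  ≈-^ zero    _ = ≈-refl
  ≈-^ (suc n) p = ≈-* p (≈-^ n p)

  ≈-cancelʳ : ∀ u → x + u ≈ y + u [mod d ] → x ≈ y [mod d ]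
  ≈-cancelʳ {x} {y} {d} u (cong-by i j eq) = cong-by i j (+-cancelʳ-≡ u _ _ (begin
    x + i * d + u ≡⟨ solve (x ∷ i ∷ d ∷ u ∷ []) ⟩
    x + u + i * d ≡⟨ eq ⟩
    y + u + j * d ≡⟨ solve (y ∷ j ∷ d ∷ u ∷ []) ⟩
    y + j * d + u ∎))
    where open ≡-Reasoning

  ∣⇒≈0 : d ∣ x → x ≈ 0 [mod d ]
  ∣⇒≈0 (divides q refl) = cong-by 0 q (+-identityʳ _)

  ≈-∣ : x ≈ y [mod d ] → d ∣ y → d ∣ x
  ≈-∣ {x} {y} {d} (cong-by i j eq) d∣y =
    ∣m+n∣m⇒∣n (subst (d ∣_) (+-comm x (i * d)) (subst (d ∣_) (sym eq) (∣m∣n⇒∣m+n d∣y (n∣m*n j)))) (n∣m*n i)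

  ≈0⇒∣ : x ≈ 0 [mod d ] → d ∣ x
  ≈0⇒∣ p = ≈-∣ p (_ ∣0)

  ≈-weaken : e ∣ d → x ≈ y [mod d ] → x ≈ y [mod e ]
  ≈-weaken {e} {d} {x} {y} (divides q refl) (cong-by i j eq) =
    cong-by (i * q) (j * q) (begin
      x + i * q * e   ≡⟨ cong (x +_) (*-assoc i q e) ⟩
      x + i * (q * e) ≡⟨ eq ⟩
      y + j * (q * e) ≡⟨ cong (y +_) (*-assoc j q e) ⟨
      y + j * q * e   ∎)
    where open ≡-Reasoning

  ≈⇒∣∸ : x ≈ y [mod d ] → ∀ {w} → x ≡ y + w → d ∣ w
  ≈⇒∣∸ {y = y} p {w} refl = ≈0⇒∣ (≈-cancelʳ y (≈-trans (≈-reflexive (+-comm w y)) p))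

  odd-or-even : ∀ n → (∃ λ j → n ≡ 2 * j) ⊎ (∃ λ j → n ≡ 1 + 2 * j)
  odd-or-even zero = inj₁ (0 , refl)
  odd-or-even (suc n) with odd-or-even n
  ... | inj₁ (j , refl) = inj₂ (j , refl)
  ... | inj₂ (j , refl) = inj₁ (suc j , solve (j ∷ []))

  ^-even : ∀ x j → x ^ (2 * j) ≡ (x * x) ^ j
  ^-even x j = trans (sym (^-*-assoc x 2 j)) (cong (λ t → (x * t) ^ j) (*-identityʳ x))

  ^-square : ∀ x j → x ^ (2 * j) ≡ x ^ j * x ^ j
  ^-square x j = trans (cong (x ^_) (cong (j +_) (+-identityʳ j))) (^-distribˡ-+-* x j j)

  -- Adding `x * y` to both sides turns them into x (x + y) and y (x + y), which both vanish modulo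
  -- d.
  neg-square : ∀ x y → x + y ≈ 0 [mod d ] → x * x ≈ y * y [mod d ]
  neg-square x y p = ≈-cancelʳ (x * y)
    (≈-trans (≈-reflexive {x = x * x + x * y} (sym (*-distribˡ-+ x x y)))
    (≈-trans (≈-* (≈-refl {x = x}) p)
    (≈-trans (≈-reflexive (*-zeroʳ x))
    (≈-sym (≈-trans (≈-reflexive {y = y * (x + y)} (solve (x ∷ y ∷ [])))
    (≈-trans (≈-* (≈-refl {x = y}) p) (≈-reflexive (*-zeroʳ y))))))))

  neg-^-even : ∀ x y j → x + y ≈ 0 [mod d ] → x ^ (2 * j) ≈ y ^ (2 * j) [mod d ]
  neg-^-even x y j p =
    ≈-trans (≈-reflexive (^-even x j)) (≈-trans (≈-^ j (neg-square x y p)) (≈-reflexive (sym (^-even y j))))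

  -- Once x ^ (2j) is replaced by y ^ (2j), the factor x + y comes out. With y = 1 this raises -1 to
  -- an odd power.
  neg-^-odd : ∀ x y j → x + y ≈ 0 [mod d ] → x ^ (1 + 2 * j) + y ^ (1 + 2 * j) ≈ 0 [mod d ]
  neg-^-odd x y j p =
    ≈-trans (≈-+ (≈-* (≈-refl {x = x}) (neg-^-even x y j p)) ≈-refl)
    (≈-trans (≈-reflexive (sym (*-distribʳ-+ (y ^ (2 * j)) x y)))
    (≈-* p ≈-refl))

  coprime-*ʳ : Coprime d m → Coprime d n → Coprime d (m * n)
  coprime-*ʳ {d} {m} {n} p q {i} (i∣d , i∣mn) =
    q (i∣d , coprime-divisor {i} {m} (λ (k∣i , k∣m) → p (∣-trans k∣i i∣d , k∣m)) i∣mn)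

  coprime-^ʳ : ∀ n → Coprime d m → Coprime d (m ^ n)
  coprime-^ʳ zero    _ (_ , i∣1) = ∣1⇒≡1 i∣1
  coprime-^ʳ (suc n) p = coprime-*ʳ p (coprime-^ʳ n p)

  coprime-^ˡ : ∀ n → Coprime m d → Coprime (m ^ n) d
  coprime-^ˡ n p = coprime-sym (coprime-^ʳ n (coprime-sym p))

  coprime-∣ˡ : e ∣ d → Coprime d m → Coprime e m
  coprime-∣ˡ e∣d p (i∣e , i∣m) = p (∣-trans i∣e e∣d , i∣m)

  gcd-cofactors-coprime : .{{_ : NonZero e}} → gcd (m * e) (n * e) ≡ e → Coprime m n
  gcd-cofactors-coprime {e} gcd≡ {i} (i∣m , i∣n) = ∣1⇒≡1 (*-cancelʳ-∣ e (subst (i * e ∣_) (sym (*-identityˡ e))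
    (subst (i * e ∣_) gcd≡ (gcd-greatest (*-monoˡ-∣ e i∣m) (*-monoˡ-∣ e i∣n)))))

  coprime-≈ : x ≈ y [mod d ] → Coprime d y → Coprime d x
  coprime-≈ p c (i∣d , i∣x) = c (i∣d , ≈-∣ (≈-sym (≈-weaken i∣d p)) i∣x)

  ∣⇒coprime⇒≡1 : d ∣ m → Coprime d m → d ≡ 1
  ∣⇒coprime⇒≡1 d∣m c = c (∣-refl , d∣m)

  ∣2⇒ : d ∣ 2 → d ≡ 1 ⊎ d ≡ 2
  ∣2⇒ {0} p = contradiction (0∣⇒≡0 p) λ ()
  ∣2⇒ {1} p = inj₁ refl
  ∣2⇒ {2} p = inj₂ refl
  ∣2⇒ {suc (suc (suc d))} p = contradiction (∣⇒≤ p) λ { (s≤s (s≤s ())) }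

  odd⇒coprime2 : ¬ 2 ∣ d → Coprime 2 d
  odd⇒coprime2 odd (i∣2 , i∣d) with ∣2⇒ i∣2
  ... | inj₁ i≡1  = i≡1
  ... | inj₂ refl = contradiction i∣d odd

  2∤1+2* : ∀ j → ¬ 2 ∣ 1 + 2 * j
  2∤1+2* j p = contradiction (∣1⇒≡1 (∣m+n∣m⇒∣n (subst (2 ∣_) (+-comm 1 (2 * j)) p) (m∣m*n j))) λ ()

  odd⇒≥3 : ¬ 2 ∣ d → d ≢ 1 → 3 ≤ d
  odd⇒≥3 {0} odd _ = contradiction (2 ∣0) odd
  odd⇒≥3 {1} _ d≢1 = contradiction refl d≢1
  odd⇒≥3 {2} odd _ = contradiction ∣-refl odd
  odd⇒≥3 {suc (suc (suc d))} _ _ = s≤s (s≤s (s≤s z≤n))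

  ∣2^⇒2^ : ∀ e → d ∣ 2 ^ e → ∃ λ j → d ≡ 2 ^ j
  ∣2^⇒2^ zero p = 0 , ∣1⇒≡1 p
  ∣2^⇒2^ {d} (suc e) p with 2 ∣? d
  ... | yes (divides c refl)
    with j , refl ← ∣2^⇒2^ {c} e (*-cancelˡ-∣ 2 (subst (_∣ 2 * 2 ^ e) (*-comm c 2) p)) = suc j , *-comm (2 ^ j) 2
  ... | no odd = ∣2^⇒2^ e (coprime-divisor {d} {2} (coprime-sym (odd⇒coprime2 odd)) p)

  odd∣2^⇒≡1 : ∀ e → ¬ 2 ∣ d → d ∣ 2 ^ e → d ≡ 1
  odd∣2^⇒≡1 e odd p = coprime-^ʳ e (coprime-sym (odd⇒coprime2 odd)) (∣-refl , p)

  two-adic : ∀ n → n ≢ 0 → ∃₂ λ l o → n ≡ 2 ^ l * (1 + 2 * o)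
  two-adic = <-rec _ step
    where
    step : ∀ n → (∀ {k} → k < n → k ≢ 0 → ∃₂ λ l o → k ≡ 2 ^ l * (1 + 2 * o)) →
           n ≢ 0 → ∃₂ λ l o → n ≡ 2 ^ l * (1 + 2 * o)
    step n rec n≢0 with odd-or-even n
    ... | inj₂ (j , refl) = 0 , j , sym (+-identityʳ _)
    ... | inj₁ (zero , refl) = contradiction refl n≢0
    ... | inj₁ (suc j , refl)
      with l , o , eq ← rec {suc j} (m<m+n (suc j) (s≤s z≤n)) (λ ()) =
        suc l , o , trans (cong (2 *_) eq) (sym (*-assoc 2 (2 ^ l) _))

-- Lifting the exponent for differences and sums of powers.

module Lifting where
  open Congruence
  open import Data.Nat using (ℕ; zero; suc; NonZero; ≢-nonZero; ≢-nonZero⁻¹)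
  import Data.Nat as ℕ
  import Data.Nat.Properties as ℕₚ
  open import Data.Nat.Divisibility
  open import Data.Nat.Coprimality using (Coprime; coprime-divisor) renaming (sym to coprime-sym)
  open import Data.Nat.GCD using (gcd; gcd[m,n]∣m; gcd[m,n]∣n; gcd-greatest)
  open import Data.Integer using (ℤ; +_; -_; ∣_∣; _+_; _*_; _-_; _^_)
  open import Data.Integer.Properties
  open import Data.Integer.Divisibility.Signed using (∣⇒∣ᵤ; ∣ᵤ⇒∣) renaming (_∣_ to _∣ₛ_)
  import Data.Integer.Divisibility.Signed as S
  open import Data.Integer.Tactic.RingSolver using (solve-∀)
  open import Data.Product using (∃; _,_)
  open import Relation.Nullary using (contradiction)
  open import Relation.Binary.PropositionalEquality

  -- The quotient (x ^ n - y ^ n) / (x - y) as the sum of all x ^ i y ^ (n - 1 - i), in Horner form.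
  -- Integers allow y to be negated, which later covers sums of odd powers.
  geo : ℤ → ℤ → ℕ → ℤ
  geo x y zero    = + 0
  geo x y (suc n) = x * geo x y n + y ^ n

  geo-telescope : ∀ x y n → x ^ n - y ^ n ≡ (x - y) * geo x y n
  geo-telescope x y zero    = sym (*-zeroʳ (x - y))
  geo-telescope x y (suc n) = begin
    x * x ^ n - y * y ^ n                     ≡⟨ ring₁ x y (x ^ n) (y ^ n) ⟩
    x * (x ^ n - y ^ n) + (x - y) * y ^ n     ≡⟨ cong (λ t → x * t + (x - y) * y ^ n) (geo-telescope x y n) ⟩
    x * ((x - y) * geo x y n) + (x - y) * y ^ n ≡⟨ ring₂ x y (geo x y n) (y ^ n) ⟩
    (x - y) * (x * geo x y n + y ^ n)         ∎
    where
    open ≡-Reasoning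
    ring₁ : ∀ x y u v → x * u - y * v ≡ x * (u - v) + (x - y) * v
    ring₁ = solve-∀
    ring₂ : ∀ x y g v → x * ((x - y) * g) + (x - y) * v ≡ (x - y) * (x * g + v)
    ring₂ = solve-∀

  -- Modulo x - y each of the `suc n` terms of the sum equals x ^ n. In the induction y ^ suc n is
  -- traded for x ^ suc n by `geo-telescope`.
  geo-mod : ∀ x y n → ∃ λ r → geo x y (suc n) ≡ + suc n * x ^ n + (x - y) * r
  geo-mod x y zero    = + 0 , ring x y
    where
    ring : ∀ x y → x * + 0 + + 1 ≡ + 1 * + 1 + (x - y) * + 0
    ring = solve-∀
  geo-mod x y (suc n) with r , eq ← geo-mod x y n = x * r - geo x y (suc n) , (begin
    x * G + y ^ suc n                                         ≡⟨ ring₁ (x * G) (x ^ suc n) (y ^ suc n) ⟩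
    x * G + (x ^ suc n - (x ^ suc n - y ^ suc n))             ≡⟨ cong₂ (λ s t → x * s + (x ^ suc n - t)) eq (geo-telescope x y (suc n)) ⟩
    x * (+ suc n * x ^ n + (x - y) * r) + (x * x ^ n - (x - y) * G)
                                                              ≡⟨ ring₂ x y (+ suc n) (x ^ n) r G ⟩
    (+ 1 + + suc n) * (x * x ^ n) + (x - y) * (x * r - G)     ∎)
    where
    open ≡-Reasoning
    G = geo x y (suc n)
    ring₁ : ∀ g u v → g + v ≡ g + (u - (u - v))
    ring₁ = solve-∀
    ring₂ : ∀ x y k u r g → x * (k * u + (x - y) * r) + (x * u - (x - y) * g) ≡
                            (+ 1 + k) * (x * u) + (x - y) * (x * r - g)
    ring₂ = solve-∀

  geo-+ : ∀ x y m n → geo x y (m ℕ.+ n) ≡ x ^ m * geo x y n + y ^ n * geo x y m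
  geo-+ x y zero n = ring (geo x y n) (y ^ n)
    where
    ring : ∀ g v → g ≡ + 1 * g + v * + 0
    ring = solve-∀
  geo-+ x y (suc m) n = begin
    x * geo x y (m ℕ.+ n) + y ^ (m ℕ.+ n)
      ≡⟨ cong₂ (λ s t → x * s + t) (geo-+ x y m n) (^-distribˡ-+-* y m n) ⟩
    x * (x ^ m * geo x y n + y ^ n * geo x y m) + y ^ m * y ^ n
      ≡⟨ ring x (x ^ m) (y ^ m) (y ^ n) (geo x y m) (geo x y n) ⟩
    x * x ^ m * geo x y n + y ^ n * (x * geo x y m + y ^ m) ∎
    where
    open ≡-Reasoning
    ring : ∀ x a b c g h → x * (a * h + c * g) + b * c ≡ x * a * h + c * (x * g + b)
    ring = solve-∀

  -- As fractions, the factor x ^ k - y ^ k cancels between the two quotients; since it may be zero,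
  -- the identity is proved by induction on p.
  geo-* : ∀ x y k p → geo x y (p ℕ.* k) ≡ geo x y k * geo (x ^ k) (y ^ k) p
  geo-* x y k zero    = sym (*-zeroʳ (geo x y k))
  geo-* x y k (suc p) = begin
    geo x y (k ℕ.+ p ℕ.* k)
      ≡⟨ geo-+ x y k (p ℕ.* k) ⟩
    x ^ k * geo x y (p ℕ.* k) + y ^ (p ℕ.* k) * geo x y k
      ≡⟨ cong₂ (λ s t → x ^ k * s + t * geo x y k) (geo-* x y k p)
           (trans (cong (y ^_) (ℕₚ.*-comm p k)) (sym (^-*-assoc y k p))) ⟩
    x ^ k * (geo x y k * H) + (y ^ k) ^ p * geo x y k
      ≡⟨ ring (x ^ k) (geo x y k) H ((y ^ k) ^ p) ⟩
    geo x y k * (x ^ k * H + (y ^ k) ^ p) ∎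
    where
    open ≡-Reasoning
    H = geo (x ^ k) (y ^ k) p
    ring : ∀ a g h v → a * (g * h) + v * g ≡ g * (a * h + v)
    ring = solve-∀

  abs-^ : ∀ x n → ∣ x ^ n ∣ ≡ ∣ x ∣ ℕ.^ n
  abs-^ x zero    = refl
  abs-^ x (suc n) = trans (abs-* x (x ^ n)) (cong (∣ x ∣ ℕ.*_) (abs-^ x n))

  coprime-mod-abs : ∀ {w x} u v r n → Coprime w ∣ x ∣ → u ≡ x ^ n → v ≡ u + + w * r → Coprime w ∣ v ∣
  coprime-mod-abs {w} {x} u v r n c refl refl {i} (i∣w , i∣v) = coprime-^ʳ n c (i∣w ,
    subst (i ∣_) (abs-^ x n) (∣⇒∣ᵤ {+ i} {u}
      (S.∣m+n∣n⇒∣m {+ i} {u} {+ w * r} (∣ᵤ⇒∣ {+ i} i∣v) (S.∣m⇒∣m*n r (∣ᵤ⇒∣ {+ i} {+ w} i∣w)))))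

  -- Lifting the exponent, without primes: if e = gcd d w then e divides n by
  -- geo-mod, and the factor geo (x ^ k) (y ^ k) e of geo x y (e * k) is e times
  -- a unit modulo w, precisely because w² (and not only w) divides x − y.
  geo-lifting : ∀ s {w d} x y h n .{{_ : NonZero w}} → x - y ≡ + (w ℕ.* w) * h → Coprime w ∣ x ∣ →
                d ∣ w ℕ.^ s → d ∣ ∣ geo x y n ∣ → d ∣ n
  geo-lifting zero x y h n _ _ d∣1 _ with refl ← ∣1⇒≡1 d∣1 = 1∣ n
  geo-lifting (suc s) x y h zero _ _ _ _ = _ ∣0
  geo-lifting (suc s) {w} {d} x y h n@(suc n₁) xy≡ cop d∣ws d∣g
    with gcd d w in gcd≡ | gcd[m,n]∣m d w | gcd[m,n]∣n d w
  ... | zero | _ | e∣w = contradiction (0∣⇒≡0 e∣w) (≢-nonZero⁻¹ w)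
  ... | e@(suc e₁) | divides d′ refl | e∣w@(divides w′ refl) = e-step e∣n
    where
    coprime-d′w′ : Coprime d′ w′
    coprime-d′w′ = gcd-cofactors-coprime gcd≡
    -- Removing the factor e from d costs one power of w, because d′ is prime to w′ = w / e. This
    -- makes the induction on `s` work.
    d′∣ws : d′ ∣ w ℕ.^ s
    d′∣ws = coprime-divisor {d′} {w′} coprime-d′w′ (*-cancelʳ-∣ e
      (subst (d′ ℕ.* e ∣_) (swap w′ e (w ℕ.^ s)) d∣ws))
      where
      swap : ∀ a b c → a ℕ.* b ℕ.* c ≡ a ℕ.* c ℕ.* b
      swap a b c = trans (ℕₚ.*-assoc a b c) (trans (cong (a ℕ.*_) (ℕₚ.*-comm b c)) (sym (ℕₚ.*-assoc a c b)))
    e∣ₛx-y : + e ∣ₛ x - y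
    e∣ₛx-y = subst (+ e ∣ₛ_) (sym xy≡) (S.∣m⇒∣m*n {m = + (w ℕ.* w)} h (∣ᵤ⇒∣ {+ e} (∣m⇒∣m*n w e∣w)))
    e∣n : e ∣ n
    e∣n with r , eq ← geo-mod x y n₁ =
      coprime-divisor {e} {∣ x ∣ ℕ.^ n₁} (coprime-∣ˡ e∣w (coprime-^ʳ n₁ cop))
        (subst (e ∣_) (trans (abs-* (+ n) (x ^ n₁)) (trans (ℕₚ.*-comm n _) (cong (ℕ._* n) (abs-^ x n₁))))
          (∣⇒∣ᵤ {+ e} {+ n * x ^ n₁} (S.∣m+n∣n⇒∣m {+ e} {+ n * x ^ n₁} {(x - y) * r}
            (subst (+ e ∣ₛ_) eq (∣ᵤ⇒∣ {+ e} (∣-trans (n∣m*n d′) d∣g)))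
            (S.∣m⇒∣m*n r e∣ₛx-y))))
    e-step : e ∣ n → d ∣ n
    e-step (divides k n≡) with r , eq ← geo-mod (x ^ k) (y ^ k) e₁ =
      subst (d ∣_) (sym n≡) (*-monoˡ-∣ e
        (geo-lifting s x y h k xy≡ cop d′∣ws
          (coprime-divisor {d′} {∣ v ∣} coprime-d′v (*-cancelʳ-∣ e (subst (d′ ℕ.* e ∣_) abs-geo d∣g)))))
      where
      open ≡-Reasoning
      X = x ^ k
      r′ = + w′ * h * geo x y k * r
      v = X ^ e₁ + + w * r′
      geo-e : geo X (y ^ k) e ≡ + e * v
      geo-e = begin
        geo X (y ^ k) e                        ≡⟨ eq ⟩
        + e * X ^ e₁ + (X - y ^ k) * r         ≡⟨ cong (λ t → + e * X ^ e₁ + t * r)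
                                                   (trans (geo-telescope x y k) (cong (_* geo x y k) xy≡)) ⟩
        + e * X ^ e₁ + + (w ℕ.* w) * h * geo x y k * r
          ≡⟨ cong (λ t → + e * X ^ e₁ + t * h * geo x y k * r) (trans (pos-* w w) (cong (_* + w) (pos-* w′ e))) ⟩
        + e * X ^ e₁ + + w′ * + e * + w * h * geo x y k * r
          ≡⟨ ring (+ e) (X ^ e₁) (+ w′) (+ w) h (geo x y k) r ⟩
        + e * v                                ∎
        where
        ring : ∀ e u w′ w h g r → e * u + w′ * e * w * h * g * r ≡ e * (u + w * (w′ * h * g * r))
        ring = solve-∀
      abs-geo : ∣ geo x y n ∣ ≡ ∣ v ∣ ℕ.* ∣ geo x y k ∣ ℕ.* e
      abs-geo = begin
        ∣ geo x y n ∣                  ≡⟨ cong (λ t → ∣ geo x y t ∣) (trans n≡ (ℕₚ.*-comm k e)) ⟩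
        ∣ geo x y (e ℕ.* k) ∣          ≡⟨ cong ∣_∣ (trans (geo-* x y k e) (trans (cong (geo x y k *_) geo-e)
                                            (ring (geo x y k) (+ e) v))) ⟩
        ∣ v * geo x y k * + e ∣        ≡⟨ trans (abs-* (v * geo x y k) (+ e)) (cong (ℕ._* e) (abs-* v (geo x y k))) ⟩
        ∣ v ∣ ℕ.* ∣ geo x y k ∣ ℕ.* e  ∎
        where
        ring : ∀ g e v → g * (e * v) ≡ v * g * e
        ring = solve-∀
      coprime-d′v : Coprime d′ ∣ v ∣
      coprime-d′v = coprime-∣ˡ d′∣ws (coprime-^ˡ s
        (coprime-mod-abs (X ^ e₁) v r′ (k ℕ.* e₁) cop (^-*-assoc x k e₁) refl))

  pos-^ : ∀ x n → + (x ℕ.^ n) ≡ (+ x) ^ n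
  pos-^ x zero    = refl
  pos-^ x (suc n) = trans (pos-* x (x ℕ.^ n)) (cong (+ x *_) (pos-^ x n))

  neg-pow-odd : ∀ y j → (- y) ^ (1 ℕ.+ 2 ℕ.* j) ≡ - (y ^ (1 ℕ.+ 2 ℕ.* j))
  neg-pow-odd y j = begin
    - y * (- y) ^ (2 ℕ.* j)   ≡⟨ cong (- y *_) (^-*-assoc (- y) 2 j) ⟨
    - y * ((- y) ^ 2) ^ j     ≡⟨ cong (λ t → - y * t ^ j) (ring y) ⟩
    - y * (y ^ 2) ^ j         ≡⟨ cong (- y *_) (^-*-assoc y 2 j) ⟩
    - y * y ^ (2 ℕ.* j)       ≡⟨ neg-distribˡ-* y (y ^ (2 ℕ.* j)) ⟨
    - (y * y ^ (2 ℕ.* j))     ∎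
    where
    open ≡-Reasoning
    ring : ∀ y → - y * (- y * + 1) ≡ y * (y * + 1)
    ring = solve-∀

  lifting-quotient : ∀ s {w d} x y W n r .{{_ : NonZero W}} → w ℕ.* w ∣ W → x - y ≡ + W → Coprime w ∣ x ∣ →
                     d ∣ w ℕ.^ s → x ^ n - y ^ n ≡ + W * (+ d * r) → d ∣ n
  lifting-quotient s {zero} x y W n r (divides h W≡) _ _ _ _ =
    contradiction (trans W≡ (ℕₚ.*-zeroʳ h)) (≢-nonZero⁻¹ W)
  lifting-quotient s {w@(suc _)} {d} x y W@(suc _) n r (divides h W≡) xy≡ cop d∣ws eq =
    geo-lifting s x y (+ h) n
      (trans xy≡ (trans (cong +_ (trans W≡ (ℕₚ.*-comm h (w ℕ.* w)))) (pos-* (w ℕ.* w) h))) cop d∣ws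
      (subst (λ t → d ∣ ∣ t ∣) (sym geo≡) (subst (d ∣_) (sym (abs-* (+ d) r)) (m∣m*n ∣ r ∣)))
    where
    geo≡ : geo x y n ≡ + d * r
    geo≡ = *-cancelˡ-≡ (+ W) _ _ (trans (cong (_* geo x y n) (sym xy≡)) (trans (sym (geo-telescope x y n)) eq))

  lifting-difference : ∀ s {w d} y W n r .{{_ : NonZero W}} → w ℕ.* w ∣ W → Coprime w (y ℕ.+ W) → d ∣ w ℕ.^ s →
                       (y ℕ.+ W) ℕ.^ n ≡ y ℕ.^ n ℕ.+ W ℕ.* (d ℕ.* r) → d ∣ n
  lifting-difference s {w} {d} y W n r w²∣W cop d∣ws eq =
    lifting-quotient s (+ (y ℕ.+ W)) (+ y) W n (+ r) w²∣W
      (trans (cong (_- + y) (pos-+ y W)) (ring (+ y) (+ W))) cop d∣ws (begin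
      (+ (y ℕ.+ W)) ^ n - (+ y) ^ n                 ≡⟨ cong₂ _-_ (sym (pos-^ (y ℕ.+ W) n)) (sym (pos-^ y n)) ⟩
      + ((y ℕ.+ W) ℕ.^ n) - + (y ℕ.^ n)             ≡⟨ cong (λ t → + t - + (y ℕ.^ n)) eq ⟩
      + (y ℕ.^ n ℕ.+ W ℕ.* (d ℕ.* r)) - + (y ℕ.^ n) ≡⟨ cong (_- + (y ℕ.^ n)) (pos-+ (y ℕ.^ n) _) ⟩
      + (y ℕ.^ n) + + (W ℕ.* (d ℕ.* r)) - + (y ℕ.^ n)
        ≡⟨ ring (+ (y ℕ.^ n)) (+ (W ℕ.* (d ℕ.* r))) ⟩
      + (W ℕ.* (d ℕ.* r))                           ≡⟨ trans (pos-* W _) (cong (+ W *_) (pos-* d r)) ⟩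
      + W * (+ d * + r)                             ∎)
    where
    open ≡-Reasoning
    ring : ∀ y w → y + w - y ≡ w
    ring = solve-∀

  -- This is the lifting statement at -y: an odd exponent turns the difference of powers into a sum,
  -- and x - (-y) into x + y.
  lifting-sum : ∀ s {w d} x y j .{{_ : NonZero (x ℕ.+ y)}} → w ℕ.* w ∣ x ℕ.+ y → Coprime w x → d ∣ w ℕ.^ s →
                x ℕ.^ (1 ℕ.+ 2 ℕ.* j) ℕ.+ y ℕ.^ (1 ℕ.+ 2 ℕ.* j) ≡ (x ℕ.+ y) ℕ.* d → d ∣ 1 ℕ.+ 2 ℕ.* j
  lifting-sum s {w} {d} x y j w²∣W cop d∣ws eq =
    lifting-quotient s (+ x) (- + y) (x ℕ.+ y) n (+ 1) w²∣W
      (trans (cong (_+_ (+ x)) (neg-involutive (+ y))) (sym (pos-+ x y))) cop d∣ws (begin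
      (+ x) ^ n - (- + y) ^ n       ≡⟨ cong (_-_ ((+ x) ^ n)) (neg-pow-odd (+ y) j) ⟩
      (+ x) ^ n - - ((+ y) ^ n)     ≡⟨ cong (_+_ ((+ x) ^ n)) (neg-involutive ((+ y) ^ n)) ⟩
      (+ x) ^ n + (+ y) ^ n         ≡⟨ cong₂ _+_ (sym (pos-^ x n)) (sym (pos-^ y n)) ⟩
      + (x ℕ.^ n) + + (y ℕ.^ n)     ≡⟨ trans (sym (pos-+ (x ℕ.^ n) (y ℕ.^ n))) (cong +_ eq) ⟩
      + ((x ℕ.+ y) ℕ.* d)           ≡⟨ pos-* (x ℕ.+ y) d ⟩
      + (x ℕ.+ y) * + d             ≡⟨ cong (+ (x ℕ.+ y) *_) (*-identityʳ (+ d)) ⟨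
      + (x ℕ.+ y) * (+ d * + 1)     ∎)
    where
    open ≡-Reasoning
    n = 1 ℕ.+ 2 ℕ.* j

open Congruence
open Lifting using (lifting-sum; lifting-difference)
open import Data.Nat
open import Data.Nat.Properties
open import Data.Nat.DivMod using (_%_; _/_; m%n<n; m≡m%n+[m/n]*n)
open import Data.Nat.Divisibility
open import Data.Nat.Coprimality using (Coprime; coprime-divisor; gcd≡1⇒coprime)
  renaming (sym to coprime-sym)
open import Data.Nat.GCD using (gcd; gcd[m,n]∣m; gcd[m,n]∣n)
open import Data.Nat.Tactic.RingSolver using (solve; solve-∀)
open import Data.Fin using (Fin; toℕ; fromℕ<)
open import Data.Fin.Properties using (pigeonhole; fromℕ<-injective; toℕ<n)
open import Data.List using (_∷_; [])
open import Data.Product using (∃; ∃₂; _×_; _,_; proj₁; proj₂)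
open import Data.Sum using (_⊎_; inj₁; inj₂; [_,_]′)
open import Data.Empty using (⊥; ⊥-elim)
open import Function.Bundles using (_⇔_; mk⇔)
open import Relation.Nullary using (¬_; yes; no; contradiction)
open import Relation.Binary using (Tri; tri<; tri≈; tri>)
open import Relation.Binary.PropositionalEquality
open import Defs

private variable
  d e m n t u v x y z C N T : ℕ

-- Size bounds and power sums for Pythagorean triples.

*-^ : ∀ m n k → (m * n) ^ k ≡ m ^ k * n ^ k
*-^ m n zero    = refl
*-^ m n (suc k) = trans (cong (m * n *_) (*-^ m n k)) (ring m n (m ^ k) (n ^ k))
  where
  ring : ∀ m n u v → m * n * (u * v) ≡ m * u * (n * v)
  ring = solve-∀

^2 : ∀ n → n ^ 2 ≡ n * n
^2 n = cong (n *_) (*-identityʳ n)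

n<b^n : ∀ {b} → 2 ≤ b → ∀ n → n < b ^ n
n<b^n 2≤b zero    = s≤s z≤n
n<b^n {b} 2≤b (suc n) = begin
  2 + n             ≤⟨ s≤s (s≤s (m≤n+m n n)) ⟩
  2 + (n + n)       ≡⟨ solve (n ∷ []) ⟩
  2 * suc n         ≤⟨ *-mono-≤ 2≤b (n<b^n 2≤b n) ⟩
  b * b ^ n         ∎
  where open ≤-Reasoning

square-<-cancel : u * u < v * v → u < v
square-<-cancel {u} {v} lt = ≰⇒> λ v≤u → <⇒≱ lt (*-mono-≤ v≤u v≤u)

≤-nonZero : suc m ≤ n → NonZero n
≤-nonZero (s≤s _) = _

-- For z = 1, a + b = c contradicts (a + b)² > c². For z = 2, lowering x or y makes the left side
-- smaller than a² + b². For z ≥ 3, a ^ z + b ^ z < (a² + b²) c ^ (z - 2) = c ^ z.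
pythagorean-exponents : ∀ {a b c x y z} → 2 ≤ a → 2 ≤ b → a * a + b * b ≡ c * c → 1 ≤ x → 1 ≤ y → x ≤ z → y ≤ z →
                        a ^ x + b ^ y ≡ c ^ z → x ≡ 2 × y ≡ 2 × z ≡ 2
pythagorean-exponents {z = zero} _ _ _ 1≤x _ x≤z _ _ = contradiction (≤-trans 1≤x x≤z) λ ()
pythagorean-exponents {a} {b} {c} {1} {1} {suc zero} 2≤a 2≤b pyth _ _ _ _ eq =
  contradiction (trans pyth (sym (cong₂ _*_ a+b≡c a+b≡c))) (<⇒≢ (begin-strict
    a * a + b * b             <⟨ m<m+n _ (*-mono-≤ {1} {2} (s≤s z≤n) (*-mono-≤ (<⇒≤ 2≤a) (<⇒≤ 2≤b))) ⟩
    a * a + b * b + 2 * (a * b) ≡⟨ solve (a ∷ b ∷ []) ⟩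
    (a + b) * (a + b)         ∎))
  where
  open ≤-Reasoning
  a+b≡c : a + b ≡ c
  a+b≡c = trans (sym (cong₂ _+_ (*-identityʳ a) (*-identityʳ b))) (trans eq (*-identityʳ c))
pythagorean-exponents {x = suc (suc _)} {z = suc zero} _ _ _ _ _ (s≤s ()) _ _
pythagorean-exponents {y = suc (suc _)} {z = suc zero} _ _ _ _ _ _ (s≤s ()) _
pythagorean-exponents {a} {b} {c} {x} {y} {2} 2≤a 2≤b pyth _ _ x≤2 y≤2 eq
  with m≤n⇒m<n∨m≡n x≤2 | m≤n⇒m<n∨m≡n y≤2
... | inj₂ x≡2 | inj₂ y≡2 = x≡2 , y≡2 , refl
... | inj₁ x<2 | _ = contradiction (trans eq c²) (<⇒≢
  (+-mono-<-≤ (^-monoʳ-< a 2≤a x<2) (^-monoʳ-≤ b {{≤-nonZero 2≤b}} y≤2)))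
  where c² = trans (^2 c) (trans (sym pyth) (sym (cong₂ _+_ (^2 a) (^2 b))))
... | _ | inj₁ y<2 = contradiction (trans eq c²) (<⇒≢
  (+-mono-≤-< (^-monoʳ-≤ a {{≤-nonZero 2≤a}} x≤2) (^-monoʳ-< b 2≤b y<2)))
  where c² = trans (^2 c) (trans (sym pyth) (sym (cong₂ _+_ (^2 a) (^2 b))))
pythagorean-exponents {a} {b} {c} {x} {y} {suc (suc (suc w))} 2≤a 2≤b pyth _ _ x≤z y≤z eq =
  contradiction eq (<⇒≢ (begin-strict
    a ^ x + b ^ y         ≤⟨ +-mono-≤ (^-monoʳ-≤ a {{a≢0}} x≤z) (^-monoʳ-≤ b {{b≢0}} y≤z) ⟩
    a ^ (3 + w) + b ^ (3 + w)   ≡⟨ cong₂ _+_ (ring a (a ^ suc w)) (ring b (b ^ suc w)) ⟩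
    a * a * a ^ suc w + b * b * b ^ suc w <⟨ +-mono-<-≤
      (*-monoʳ-< (a * a) {{m*n≢0 a a {{a≢0}} {{a≢0}}}} (^-monoˡ-< (suc w) a<c))
      (*-monoʳ-≤ (b * b) (^-monoˡ-≤ (suc w) (<⇒≤ b<c))) ⟩
    a * a * c ^ suc w + b * b * c ^ suc w ≡⟨ *-distribʳ-+ (c ^ suc w) (a * a) (b * b) ⟨
    (a * a + b * b) * c ^ suc w  ≡⟨ cong (_* c ^ suc w) pyth ⟩
    c * c * c ^ suc w            ≡⟨ ring c (c ^ suc w) ⟨
    c ^ (3 + w)                  ∎))
  where
  open ≤-Reasoning
  a≢0 = ≤-nonZero 2≤a
  b≢0 = ≤-nonZero 2≤b
  ring : ∀ u v → u * (u * v) ≡ u * u * v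
  ring = solve-∀
  a<c : a < c
  a<c = square-<-cancel (subst (a * a <_) pyth (m<m+n (a * a) (*-mono-≤ (<⇒≤ 2≤b) (<⇒≤ 2≤b))))
  b<c : b < c
  b<c = square-<-cancel (subst (b * b <_) pyth
    (subst (b * b <_) (+-comm (b * b) (a * a)) (m<m+n (b * b) (*-mono-≤ (<⇒≤ 2≤a) (<⇒≤ 2≤a)))))

-- In every application w is the least of the three exponents, and i, j, l are the excesses over it;
-- only the powers of n are cancelled.
divide-common-power : ∀ a b c n w i j l .{{_ : NonZero n}} →
  (a * n) ^ (w + i) + (b * n) ^ (w + j) ≡ (c * n) ^ (w + l) →
  a ^ (w + i) * n ^ i + b ^ (w + j) * n ^ j ≡ c ^ (w + l) * n ^ l
divide-common-power a b c n w i j l eq = *-cancelˡ-≡ _ _ (n ^ w) {{m^n≢0 n w}} (begin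
  n ^ w * (a ^ (w + i) * n ^ i + b ^ (w + j) * n ^ j)
    ≡⟨ ring (n ^ w) (a ^ (w + i)) (n ^ i) (b ^ (w + j)) (n ^ j) ⟩
  a ^ (w + i) * (n ^ w * n ^ i) + b ^ (w + j) * (n ^ w * n ^ j)
    ≡⟨ cong₂ _+_ (split a i) (split b j) ⟨
  (a * n) ^ (w + i) + (b * n) ^ (w + j) ≡⟨ eq ⟩
  (c * n) ^ (w + l)                     ≡⟨ split c l ⟩
  c ^ (w + l) * (n ^ w * n ^ l)         ≡⟨ ring′ (n ^ w) (c ^ (w + l)) (n ^ l) ⟩
  n ^ w * (c ^ (w + l) * n ^ l)         ∎)
  where
  open ≡-Reasoning
  split : ∀ a i → (a * n) ^ (w + i) ≡ a ^ (w + i) * (n ^ w * n ^ i)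
  split a i = trans (*-^ a n (w + i)) (cong (a ^ (w + i) *_) (^-distribˡ-+-* n w i))
  ring : ∀ w a i b j → w * (a * i + b * j) ≡ a * (w * i) + b * (w * j)
  ring = solve-∀
  ring′ : ∀ w c l → c * (w * l) ≡ w * (c * l)
  ring′ = solve-∀

-- A common divisor d of n and c can be removed from c: the cofactor s of a
-- power of n in c ^ z, if prime to d, already divides (c / d) ^ z.
cofactor-bound : ∀ {c a n z x s i} → ¬ 2 ∣ c → c ≡ a + 2 → 3 ≤ a → n ≢ 1 → n ^ suc i * s ≡ c ^ z → z < x → a ^ x ≤ s →
                 (∀ {d} → d ∣ n → d ∣ c → Coprime d s) → ⊥
cofactor-bound {c} {a} {n} {z} {x} {s} {i} odd-c c≡ 3≤a n≢1 eq z<x a^x≤s cop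
  with gcd n c in gcd≡ | gcd[m,n]∣m n c | gcd[m,n]∣n n c
... | d | d∣n | d∣c@(divides c′ c≡c′d) = <-irrefl refl (begin-strict
  a ^ x    ≤⟨ a^x≤s ⟩
  s        ≤⟨ ∣⇒≤ {{m^n≢0 c′ z}} s∣c′^z ⟩
  c′ ^ z   ≤⟨ ^-monoˡ-≤ z (<⇒≤ c′<a) ⟩
  a ^ z    <⟨ ^-monoʳ-< a (<⇒≤ 3≤a) z<x ⟩
  a ^ x    ∎)
  where
  open ≤-Reasoning
  d≢1 : d ≢ 1
  d≢1 refl = n≢1 (coprime-^ʳ z (gcd≡1⇒coprime gcd≡)
    (∣-refl , subst (n ∣_) eq (∣m⇒∣m*n s (m∣m*n (n ^ i)))))
  3≤d : 3 ≤ d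
  3≤d = odd⇒≥3 (λ 2∣d → odd-c (∣-trans 2∣d d∣c)) d≢1
  instance
    c′≢0 : NonZero c′
    c′≢0 = ≢-nonZero λ { refl → odd-c (subst (2 ∣_) (sym c≡c′d) (2 ∣0)) }
  c′<a : c′ < a
  c′<a = *-cancelʳ-< 3 c′ a (begin-strict
    c′ * 3     ≤⟨ *-monoʳ-≤ c′ 3≤d ⟩
    c′ * d     ≡⟨ c≡c′d ⟨
    c          ≡⟨ c≡ ⟩
    a + 2      <⟨ +-monoʳ-< a {2} {3} ≤-refl ⟩
    a + 3      ≤⟨ +-monoʳ-≤ a (≤-trans 3≤a (m≤m+n a a)) ⟩
    a + (a + a) ≡⟨ solve (a ∷ []) ⟩
    a * 3      ∎)
  s∣c′^z : s ∣ c′ ^ z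
  s∣c′^z = coprime-divisor {s} {d ^ z} (coprime-^ʳ z (coprime-sym (cop d∣n d∣c)))
    (subst (s ∣_) (trans (trans (cong (_^ z) c≡c′d) (*-^ c′ d z)) (*-comm (c′ ^ z) (d ^ z)))
      (subst (s ∣_) eq (n∣m*n (n ^ suc i))))

∣sum-odd-powers : ∀ u v j → u + v ∣ u ^ (1 + 2 * j) + v ^ (1 + 2 * j)
∣sum-odd-powers u v j = ≈0⇒∣ (neg-^-odd u v j (∣⇒≈0 ∣-refl))

-- For an odd exponent, lifting makes (u ^ n + v ^ n) / (u + v) a divisor of n; this bound says that
-- the quotient is larger than n. The constant 3 is sharp, as u = v = n = 2 gives equality.
odd-power-sum-bound : ∀ {u v} j → 3 ≤ u → 3 ≤ v → suc j ≢ 1 → (u + v) * suc j < u ^ suc j + v ^ suc j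
odd-power-sum-bound zero _ _ 1≢1 = contradiction refl 1≢1
odd-power-sum-bound {u} {v} (suc j) 3≤u 3≤v _ = begin-strict
  (u + v) * (2 + j)                 ≡⟨ *-distribʳ-+ (2 + j) u v ⟩
  u * (2 + j) + v * (2 + j)         <⟨ +-mono-< (bound u 3≤u) (bound v 3≤v) ⟩
  u ^ (2 + j) + v ^ (2 + j)         ∎
  where
  open ≤-Reasoning
  bound : ∀ u → 3 ≤ u → u * (2 + j) < u ^ (2 + j)
  bound u 3≤u = *-monoʳ-< u {{≤-nonZero 3≤u}} (begin-strict
    2 + j             <⟨ +-monoˡ-< j {2} {3} ≤-refl ⟩
    3 + j             ≤⟨ s≤s (s≤s (s≤s (m≤n*m j 3))) ⟩
    3 + 3 * j         ≡⟨ solve (j ∷ []) ⟩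
    3 * suc j         ≤⟨ *-mono-≤ 3≤u (n<b^n (<⇒≤ 3≤u) j) ⟩
    u * u ^ j         ∎)

-- For x odd or x / 2 even the sum a ^ x + b ^ x is prime to c; for x / 2 odd
-- it is c² times a divisor of x / 2, hence too small.
power-sum∤ : ∀ {c a b z x} → ¬ 2 ∣ c → a * a + b * b ≡ c * c → Coprime c a → Coprime c b → 3 ≤ a → 3 ≤ b →
             z < x → a ^ x + b ^ x ∣ c ^ z → ⊥
power-sum∤ {c} {a} {b} {z} {x} odd-c pyth cop-a cop-b 3≤a 3≤b z<x S∣ = by-parity (odd-or-even x)
  where
  S = a ^ x + b ^ x
  c-2a : ∀ n → Coprime c (2 * a ^ n)
  c-2a n = coprime-*ʳ (coprime-sym (odd⇒coprime2 odd-c)) (coprime-^ʳ n cop-a)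
  a²+b²≈0 : a * a + b * b ≈ 0 [mod c ]
  a²+b²≈0 = ∣⇒≈0 (subst (c ∣_) (sym pyth) (m∣m*n c))
  2≤S : 2 ≤ S
  2≤S = +-mono-≤ (m^n>0 a {{≤-nonZero 3≤a}} x) (m^n>0 b {{≤-nonZero 3≤b}} x)
  not-coprime : Coprime S c → ⊥
  not-coprime cop = <⇒≢ 2≤S (sym (∣⇒coprime⇒≡1 S∣ (coprime-^ʳ z cop)))
  by-parity : (∃ λ j → x ≡ 2 * j) ⊎ (∃ λ j → x ≡ 1 + 2 * j) → ⊥
  -- For odd x, a ^ (2x) ≡ b ^ (2x) modulo S, while a² ≡ -b² makes a ^ (2x) + b ^ (2x) vanish modulo
  -- c. A common divisor of S and c thus divides 2 a ^ (2x), which is prime to c.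
  by-parity (inj₂ (j , refl)) = not-coprime λ {e} (e∣S , e∣c) →
    c-2a (2 * x) (e∣c , subst (λ t → e ∣ a ^ (2 * x) + t) (sym (+-identityʳ _))
      (≈0⇒∣ (≈-trans (≈-+ ≈-refl (a≈b e∣S))
        (≈-trans (≈-reflexive (cong₂ _+_ (^-even a x) (^-even b x)))
        (≈-weaken e∣c (neg-^-odd (a * a) (b * b) j a²+b²≈0))))))
    where
    a≈b : ∀ {e} → e ∣ S → a ^ (2 * x) ≈ b ^ (2 * x) [mod e ]
    a≈b e∣S = ≈-trans (≈-reflexive (^-square a x)) (≈-trans (neg-square (a ^ x) (b ^ x) (∣⇒≈0 e∣S))
      (≈-reflexive (sym (^-square b x))))
  by-parity (inj₁ (X , refl)) with odd-or-even X
  ... | inj₁ (j , refl) = not-coprime (coprime-sym (coprime-≈ S≈ (c-2a x)))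
    where
    S≈ : S ≈ 2 * a ^ x [mod c ]
    S≈ = ≈-trans (≈-+ (≈-refl {x = a ^ x})
           (≈-sym (≈-trans (≈-reflexive (^-even a (2 * j))) (≈-trans (neg-^-even (a * a) (b * b) j a²+b²≈0)
             (≈-reflexive (sym (^-even b (2 * j))))))))
         (≈-reflexive (cong (a ^ x +_) (sym (+-identityʳ (a ^ x)))))
  ... | inj₂ (j , refl) = by-size (∣sum-odd-powers A B j)
    where
    A = a * a
    B = b * b
    square≥3 : ∀ {u} → 3 ≤ u → 3 ≤ u * u
    square≥3 3≤u = *-mono-≤ {1} (≤-trans (s≤s z≤n) 3≤u) 3≤u
    instance
      A+B≢0 : NonZero (A + B)
      A+B≢0 = ≤-nonZero (≤-trans (square≥3 3≤a) (m≤m+n A B))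
      c≢0 : NonZero c
      c≢0 = ≢-nonZero λ { refl → odd-c (2 ∣0) }
    S≡ : S ≡ A ^ X + B ^ X
    S≡ = cong₂ _+_ (^-even a X) (^-even b X)
    by-size : A + B ∣ A ^ X + B ^ X → ⊥
    by-size (divides D eq) with lifting-sum z A B j (∣-reflexive (sym pyth)) (coprime-*ʳ cop-a cop-a)
      (∣-trans (divides (A + B) (trans S≡ (trans eq (*-comm D (A + B))))) S∣) (trans eq (*-comm D (A + B)))
    ... | D∣X with X ≟ 1
    ... | no X≢1 = <-irrefl refl (begin-strict
      (A + B) * X     <⟨ odd-power-sum-bound (2 * j) (square≥3 3≤a) (square≥3 3≤b) X≢1 ⟩
      A ^ X + B ^ X   ≡⟨ trans eq (*-comm D (A + B)) ⟩
      (A + B) * D     ≤⟨ *-monoʳ-≤ (A + B) (∣⇒≤ D∣X) ⟩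
      (A + B) * X     ∎)
      where open ≤-Reasoning
    -- Now x = 2 and S = c², which cannot divide c ^ z with z < 2.
    ... | yes X≡1 = <-irrefl refl (begin-strict
      c ^ z           <⟨ ^-monoʳ-< c (<⇒≤ (odd⇒≥3 odd-c c≢1)) z<x ⟩
      c ^ (2 * X)     ≡⟨ cong (λ t → c ^ (2 * t)) X≡1 ⟩
      c ^ 2           ≡⟨ ^2 c ⟩
      c * c           ≡⟨ pyth ⟨
      A + B           ≡⟨ cong₂ _+_ (sym (*-identityʳ A)) (sym (*-identityʳ B)) ⟩
      A ^ 1 + B ^ 1   ≡⟨ cong (λ t → A ^ t + B ^ t) X≡1 ⟨
      A ^ X + B ^ X   ≡⟨ S≡ ⟨
      S               ≤⟨ ∣⇒≤ {{m^n≢0 c z}} S∣ ⟩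
      c ^ z           ∎)
      where
      open ≤-Reasoning
      c≢1 : c ≢ 1
      c≢1 c≡1 = contradiction (≤-trans (square≥3 3≤a) (≤-trans (m≤m+n A B) (≤-reflexive (trans pyth (cong₂ _*_ c≡1 c≡1)))))
        λ { (s≤s ()) }

-- Here u² = c² − v², so u ^ (x − 2) divides (c² ^ j − v² ^ j) / (c² − v²), hence j.
even-exponent-bound : ∀ {u v c x N j} → u * u + v * v ≡ c * c → Coprime u c → 2 ≤ u → 2 * suc j < x →
                      u ^ x * N + v ^ (2 * suc j) ≡ c ^ (2 * suc j) → ⊥
even-exponent-bound {u} {v} {c} {suc (suc x)} {N} {j} pyth cop 2≤u (s≤s (s≤s 2j<x)) eq = <-irrefl refl (begin-strict
  suc j         ≤⟨ ≤-trans (m≤m+n (suc j) _) (≤-trans (≤-reflexive (sym (+-suc j (j + 0)))) 2j<x) ⟩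
  x             <⟨ n<b^n 2≤u x ⟩
  u ^ x         ≤⟨ ∣⇒≤ (lifting-difference x (v * v) (u * u) (suc j) N ∣-refl cop′ ∣-refl eq′) ⟩
  suc j         ∎)
  where
  open ≤-Reasoning
  instance
    u²≢0 : NonZero (u * u)
    u²≢0 = m*n≢0 u u {{≤-nonZero 2≤u}} {{≤-nonZero 2≤u}}
  c²≡ : v * v + u * u ≡ c * c
  c²≡ = trans (+-comm (v * v) (u * u)) pyth
  cop′ : Coprime u (v * v + u * u)
  cop′ = subst (Coprime u) (sym c²≡) (coprime-*ʳ cop cop)
  eq′ : (v * v + u * u) ^ suc j ≡ (v * v) ^ suc j + u * u * (u ^ x * N)
  eq′ = trans (cong (_^ suc j) c²≡) (trans (sym (^-even c (suc j))) (trans (sym eq)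
    (trans (+-comm (u * (u * u ^ x) * N) _) (cong₂ _+_ (^-even v (suc j)) (ring u (u ^ x) N)))))
    where
    ring : ∀ u w N → u * (u * w) * N ≡ u * u * (w * N)
    ring = solve-∀

-- The roots are r = gcd x u and s = x / r. As s is prime to u / r, it divides v, so r is prime to v
-- and s to u. Hence r ^ suc k ∣ u and s ^ suc k ∣ v, and the two cofactors have product 1.
coprime-root : ∀ k .{{_ : NonZero x}} → Coprime u v → u * v ≡ x ^ suc k →
               ∃₂ λ r s → r * s ≡ x × u ≡ r ^ suc k × v ≡ s ^ suc k
coprime-root {x} {u} {v} k cop uv≡ with gcd x u in gcd≡ | gcd[m,n]∣m x u | gcd[m,n]∣n x u
... | zero | 0∣x | _ = contradiction (0∣⇒≡0 0∣x) (≢-nonZero⁻¹ x)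
... | r@(suc _) | divides s x≡sr | r∣u@(divides u′ u≡u′r) = conclude r^∣u s^∣v
  where
  s∣v : s ∣ v
  s∣v = coprime-divisor {s} {u′} (gcd-cofactors-coprime {r} (trans (cong₂ gcd (sym x≡sr) (sym u≡u′r)) gcd≡))
    (*-cancelʳ-∣ r (subst₂ _∣_ x≡sr (trans (sym uv≡) (trans (cong (_* v) u≡u′r) (ring u′ r v))) (m∣m*n (x ^ k))))
    where
    ring : ∀ u r v → u * r * v ≡ u * v * r
    ring = solve-∀
  x^≡ : x ^ suc k ≡ s ^ suc k * r ^ suc k
  x^≡ = trans (cong (_^ suc k) x≡sr) (*-^ s r (suc k))
  r^∣u : r ^ suc k ∣ u
  r^∣u = coprime-divisor {r ^ suc k} {v} (coprime-^ˡ (suc k) (coprime-∣ˡ r∣u cop))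
    (subst (r ^ suc k ∣_) (trans (sym x^≡) (trans (sym uv≡) (*-comm u v))) (n∣m*n (s ^ suc k)))
  s^∣v : s ^ suc k ∣ v
  s^∣v = coprime-divisor {s ^ suc k} {u} (coprime-^ˡ (suc k) (coprime-∣ˡ s∣v (coprime-sym cop)))
    (subst (s ^ suc k ∣_) (trans (sym x^≡) (sym uv≡)) (m∣m*n (r ^ suc k)))
  conclude : r ^ suc k ∣ u → s ^ suc k ∣ v → ∃₂ λ r s → r * s ≡ x × u ≡ r ^ suc k × v ≡ s ^ suc k
  conclude (divides i refl) (divides j refl) = r , s , trans (*-comm r s) (sym x≡sr) ,
    trans (cong (_* r ^ suc k) (m*n≡1⇒m≡1 i j ij≡1)) (*-identityˡ _) ,
    trans (cong (_* s ^ suc k) (m*n≡1⇒n≡1 i j ij≡1)) (*-identityˡ _)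
    where
    ring : ∀ i j u v → i * j * (v * u) ≡ i * u * (j * v)
    ring = solve-∀
    ij≡1 : i * j ≡ 1
    ij≡1 = *-cancelʳ-≡ (i * j) 1 (x ^ suc k) {{m^n≢0 x (suc k)}} (trans (cong (i * j *_) x^≡)
      (trans (ring i j (r ^ suc k) (s ^ suc k)) (trans uv≡ (sym (*-identityˡ _)))))

-- Multiplicative orders and Fermat numbers.

2<⇒2≉0 : 2 < d → ¬ 1 + 1 ≈ 0 [mod d ]
2<⇒2≉0 2<d p = <⇒≱ 2<d (∣⇒≤ (≈0⇒∣ p))

-- By pigeonhole u has an order δ < 2 ^ (1 + E) modulo d unless d is large;
-- u ^ δ ≈ 1 contradicts u ^ 2 ^ E ≈ −1 because δ has 2-adic valuation at most E.
order-bound : ∀ E → 2 < d → u ^ (2 ^ E) + 1 ≈ 0 [mod d ] → 2 ^ suc E ≤ d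
order-bound {d} {u} E 2<d p = ≮⇒≥ λ d<K → no-collision d<K (pigeonhole d<K residue)
  where
  instance
    d≢0 : NonZero d
    d≢0 = ≤-nonZero 2<d
  K = 2 ^ suc E
  residue : Fin K → Fin d
  residue i = fromℕ< (m%n<n (u ^ toℕ i) d)
  ≈-% : ∀ x → x ≈ x % d [mod d ]
  ≈-% x = cong-by 0 (x / d) (trans (+-identityʳ x) (m≡m%n+[m/n]*n x d))
  u^K≈1 : u ^ K ≈ 1 [mod d ]
  u^K≈1 = ≈-trans (≈-reflexive (trans (cong (u ^_) (*-comm 2 (2 ^ E))) (sym (^-*-assoc u (2 ^ E) 2))))
    (neg-^-even (u ^ (2 ^ E)) 1 1 p)
  no-order : ∀ δ → 0 < δ → δ < K → u ^ δ ≈ 1 [mod d ] → ⊥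
  no-order δ 0<δ δ<K p′ with two-adic δ (λ { refl → contradiction 0<δ λ () })
  ... | l , o , refl with l ≤? E
  ... | no l≰E = <⇒≱ δ<K (≤-trans (^-monoʳ-≤ 2 (≰⇒> l≰E)) (m≤m*n (2 ^ l) (1 + 2 * o)))
  -- With E = l + k, the odd power (u ^ 2 ^ E) ^ (1 + 2o) equals (u ^ δ) ^ 2 ^ k ≡ 1, but as an odd
  -- power of -1 it is also -1.
  ... | yes l≤E with k , refl ← m≤n⇒∃[o]m+o≡n l≤E =
    2<⇒2≉0 2<d (≈-trans (≈-+ (≈-sym big≈1) (≈-reflexive (sym (^-zeroˡ (1 + 2 * o)))))
      (neg-^-odd (u ^ (2 ^ (l + k))) 1 o p))
    where
    ring : ∀ l o k → l * o * k ≡ l * k * o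
    ring = solve-∀
    big≈1 : (u ^ (2 ^ (l + k))) ^ (1 + 2 * o) ≈ 1 [mod d ]
    big≈1 = ≈-trans (≈-reflexive (trans (^-*-assoc u (2 ^ (l + k)) (1 + 2 * o))
        (trans (cong (u ^_) (trans (cong (_* (1 + 2 * o)) (^-distribˡ-+-* 2 l k)) (sym (ring (2 ^ l) (1 + 2 * o) (2 ^ k)))))
          (sym (^-*-assoc u (2 ^ l * (1 + 2 * o)) (2 ^ k))))))
      (≈-trans (≈-^ (2 ^ k) p′) (≈-reflexive (^-zeroˡ (2 ^ k))))
  no-collision : d < K → (∃₂ λ i j → toℕ i < toℕ j × residue i ≡ residue j) → ⊥
  no-collision _ (i , j , i<j , eq)
    with δ , i+δ≡j ← m≤n⇒∃[o]m+o≡n (<⇒≤ i<j) | k , i+k≡K ← m≤n⇒∃[o]m+o≡n (<⇒≤ (toℕ<n i)) =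
    no-order δ 0<δ (≤-<-trans (m≤n+m δ (toℕ i)) (subst (_< K) (sym i+δ≡j) (toℕ<n j))) u^δ≈1
    where
    0<δ : 0 < δ
    0<δ = +-cancelˡ-< (toℕ i) 0 δ (subst₂ _<_ (sym (+-identityʳ _)) (sym i+δ≡j) i<j)
    u^i≈u^j : u ^ toℕ i ≈ u ^ toℕ j [mod d ]
    u^i≈u^j = ≈-trans (≈-% _) (≈-trans (≈-reflexive
      (fromℕ<-injective _ _ (m%n<n (u ^ toℕ i) d) (m%n<n (u ^ toℕ j) d) eq)) (≈-sym (≈-% _)))
    ring : ∀ a b c → a * b * c ≡ a * c * b
    ring = solve-∀
    -- Since i + k = K, u ^ k is an inverse of u ^ i, so the collision u ^ i ≡ u ^ j can be divided
    -- by u ^ i.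
    u^i*u^k≈1 : u ^ toℕ i * u ^ k ≈ 1 [mod d ]
    u^i*u^k≈1 = ≈-trans (≈-reflexive (trans (sym (^-distribˡ-+-* u (toℕ i) k)) (cong (u ^_) i+k≡K))) u^K≈1
    u^δ≈1 : u ^ δ ≈ 1 [mod d ]
    u^δ≈1 = ≈-trans (≈-reflexive (sym (*-identityˡ (u ^ δ)))) (≈-trans (≈-* (≈-sym u^i*u^k≈1) (≈-refl {x = u ^ δ}))
      (≈-trans (≈-reflexive (trans (ring (u ^ toℕ i) (u ^ k) (u ^ δ))
        (cong (_* u ^ k) (trans (sym (^-distribˡ-+-* u (toℕ i) δ)) (cong (u ^_) i+δ≡j)))))
      (≈-trans (≈-* (≈-sym u^i≈u^j) (≈-refl {x = u ^ k})) u^i*u^k≈1)))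

suc-of : ∀ n → n ≢ 0 → ∃ λ k → n ≡ suc k
suc-of zero    0≢0 = contradiction refl 0≢0
suc-of (suc n) _   = n , refl

2^≢0 : ∀ n → 2 ^ n ≢ 0
2^≢0 n eq = contradiction (m^n≡0⇒m≡0 2 n eq) λ ()

-- Here a is the product of the Fermat numbers of index below k. The proof peels off one at a time:
-- with Q ² = a + 1, a = (Q + 1)(Q - 1), and a divisor prime to Q + 1 divides Q - 1.
fermat-common-divisor : ∀ {a d} k → a + 1 ≡ 2 ^ (2 ^ k) → d ∣ a → d ≢ 1 →
                        ∃₂ λ i e → i < k × e ≢ 1 × e ∣ d × e ∣ 2 ^ (2 ^ i) + 1
fermat-common-divisor {a} zero a+1≡2 d∣a d≢1 =
  contradiction (∣1⇒≡1 (subst (_ ∣_) (+-cancelʳ-≡ 1 a 1 a+1≡2) d∣a)) d≢1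
fermat-common-divisor {a} {d} (suc k) a+1≡ d∣a d≢1 with suc-of (2 ^ (2 ^ k)) (2^≢0 (2 ^ k))
-- `r` is Q - 1, so `2 + r` is the Fermat number Q + 1.
... | r , Q≡ with gcd d (2 + r) in gcd≡
... | e with e ≟ 1
... | no e≢1 = k , e , ≤-refl , e≢1 , subst (_∣ d) gcd≡ (gcd[m,n]∣m d (2 + r)) ,
  subst₂ _∣_ gcd≡ (trans (cong suc (sym Q≡)) (+-comm 1 _)) (gcd[m,n]∣n d (2 + r))
... | yes refl with fermat-common-divisor k (trans (+-comm r 1) (sym Q≡)) d∣r d≢1
  where
  a≡ : a ≡ (2 + r) * r
  a≡ = +-cancelʳ-≡ 1 _ _ (trans a+1≡ (trans (cong (2 ^_) (*-comm 2 (2 ^ k))) (trans (sym (^-*-assoc 2 (2 ^ k) 2))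
    (trans (^2 (2 ^ (2 ^ k))) (trans (cong₂ _*_ Q≡ Q≡) (solve (r ∷ [])))))))
  d∣r : d ∣ r
  d∣r = coprime-divisor {d} {2 + r} (gcd≡1⇒coprime gcd≡) (subst (d ∣_) a≡ d∣a)
... | i , e , i<k , rest = i , e , m<n⇒m<1+n i<k , rest

-- Powers of odd numbers modulo powers of 2, and differences of squares.

odd-factor : ∀ m {q} → q ≡ 2 ^ suc m → t * n + 1 ≡ q * q → ∃ λ v → t ≡ 1 + 2 * v
odd-factor {t} {n} m refl tn+1≡ with odd-or-even t
... | inj₂ t-odd = t-odd
... | inj₁ (j , refl) = contradiction (∣m+n∣m⇒∣n (subst (2 ∣_) (sym tn+1≡) (∣m⇒∣m*n _ (m∣m*n (2 ^ m))))
                          (∣m⇒∣m*n n (m∣m*n j))) λ p → contradiction (∣1⇒≡1 p) λ ()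

-- Thus t ^ (2X + 1) - 1 and t - 1 have the same 2-adic valuation: their quotient is a sum of an odd
-- number of odd terms.
odd-power-unit : ∀ v X → ∃ λ h → (1 + 2 * v) ^ (1 + 2 * X) ≡ 1 + 2 * v * (1 + 2 * h)
odd-power-unit v zero = 0 , trans (*-identityʳ (1 + 2 * v)) (cong suc (sym (*-identityʳ (2 * v))))
odd-power-unit v (suc X) with h , eq ← odd-power-unit v X =
  -- The new h′ solves t² (1 + 2v (1 + 2h)) = 1 + 2v (1 + 2h′) with t = 1 + 2v; the coefficient of h
  -- is t².
  1 + v + h * (4 * v * v + 4 * v + 1) + 2 * v * v + 2 * v , (begin
  (1 + 2 * v) ^ (1 + 2 * suc X)                           ≡⟨ cong (λ k → (1 + 2 * v) ^ suc k) (*-suc 2 X) ⟩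
  (1 + 2 * v) * ((1 + 2 * v) * (1 + 2 * v) ^ (1 + 2 * X))     ≡⟨ cong (λ s → (1 + 2 * v) * ((1 + 2 * v) * s)) eq ⟩
  (1 + 2 * v) * ((1 + 2 * v) * (1 + 2 * v * (1 + 2 * h))) ≡⟨ solve (v ∷ h ∷ []) ⟩
  1 + 2 * v * (1 + 2 * (1 + v + h * (4 * v * v + 4 * v + 1) + 2 * v * v + 2 * v)) ∎)
  where
  open ≡-Reasoning

odd-root-of-unity : ∀ s v X → 1 + 2 * v < 2 ^ s → (1 + 2 * v) ^ (1 + 2 * X) ≈ 1 [mod 2 ^ s ] → v ≡ 0
odd-root-of-unity s zero    X _ _ = refl
odd-root-of-unity s (suc v) X t< p with h , eq ← odd-power-unit (suc v) X =
  contradiction (∣⇒≤ (coprime-divisor {2 ^ s} {1 + 2 * h} (coprime-^ˡ s (odd⇒coprime2 (2∤1+2* h)))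
    (subst (2 ^ s ∣_) (*-comm (2 * suc v) (1 + 2 * h)) (≈⇒∣∸ p eq)))) (<⇒≱ (≤-trans (n≤1+n _) t<))

-- t ≡ ±1 modulo 2q forces n ≡ ∓1, and then t n is too large.
no-unit-factor : ∀ m {q v} → q ≡ 2 ^ suc m → (1 + 2 * suc v) * n + 1 ≡ q * q → n ≢ 1 → ¬ q ∣ suc v * (suc v + 1)
no-unit-factor {n} m {q} {v} q≡ tn+1≡ n≢1 q∣ = <⇒≱ tn<q² (by-parity (odd-or-even V))
  where
  V = suc v
  τ = 1 + 2 * V
  1≤q : 1 ≤ q
  1≤q = subst (1 ≤_) (sym q≡) (m^n>0 2 (suc m))
  2≤q : 2 ≤ q
  2≤q = subst (2 ≤_) (sym q≡) (m≤m*n 2 (2 ^ m) {{m^n≢0 2 m}})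
  tn<q² : τ * n < q * q
  tn<q² = ≤-reflexive (trans (+-comm 1 (τ * n)) tn+1≡)
  n≢0 : n ≢ 0
  n≢0 n≡0 = <⇒≢ (*-mono-≤ {1} 1≤q 2≤q) (trans (sym (cong (_+ 1) (trans (cong (τ *_) n≡0) (*-zeroʳ τ)))) tn+1≡)
  2q∣q² : 2 * q ∣ q * q
  2q∣q² = subst (2 * q ∣_) (cong (_* q) (sym q≡)) (*-monoˡ-∣ q (m∣m*n {2} (2 ^ m)))
  tn+1≈0 : τ * n + 1 ≈ 0 [mod 2 * q ]
  tn+1≈0 = ∣⇒≈0 (subst (2 * q ∣_) (sym tn+1≡) 2q∣q²)
  ≤-pred-double : ∀ {k} → 2 * q ≤ k + 1 → q ≤ k
  ≤-pred-double {k} le = +-cancelʳ-≤ 1 q k (≤-trans (+-monoʳ-≤ q 1≤q) (≤-trans (≤-reflexive (cong (q +_) (sym (+-identityʳ q)))) le))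
  product : q ≤ τ → q ≤ n → q * q ≤ τ * n
  product = *-mono-≤
  q-coprime : ∀ {k} → ¬ 2 ∣ k → Coprime q k
  q-coprime odd = subst (λ q → Coprime q _) (sym q≡) (coprime-^ˡ (suc m) (odd⇒coprime2 odd))
  plus : q ∣ V → q * q ≤ τ * n
  plus q∣V = product (≤-trans (∣⇒≤ q∣V) (≤-trans (m≤n*m V 2) (n≤1+n _)))
    (≤-pred-double (∣⇒≤ {{≢-nonZero λ p → contradiction (trans (+-comm 1 n) p) λ ()}} (≈0⇒∣ n+1≈0)))
    where
    t≈1 : τ ≈ 1 [mod 2 * q ]
    t≈1 = ≈-+ (≈-refl {x = 1}) (∣⇒≈0 (*-monoʳ-∣ 2 q∣V))
    n+1≈0 : n + 1 ≈ 0 [mod 2 * q ]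
    n+1≈0 = ≈-trans (≈-+ (≈-trans (≈-reflexive (sym (*-identityˡ n))) (≈-* (≈-sym t≈1) (≈-refl {x = n}))) ≈-refl) tn+1≈0
  minus : q ∣ V + 1 → q * q ≤ τ * n
  minus q∣V+1 with w , n≡ ← suc-of n n≢0 =
    product (≤-pred-double (∣⇒≤ {{≢-nonZero λ p → contradiction (trans (+-comm 1 τ) p) λ ()}} 2q∣t+1))
      (subst (q ≤_) (sym n≡) (≤-trans (m≤n*m q 2) (≤-trans (∣⇒≤ {{w≢0 n≡}} (≈⇒∣∸ n≈1 n≡)) (n≤1+n w))))
    where
    w≢0 : ∀ {w} → n ≡ suc w → NonZero w
    w≢0 n≡ = ≢-nonZero λ w≡0 → n≢1 (trans n≡ (cong suc w≡0))
    2q∣t+1 : 2 * q ∣ τ + 1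
    2q∣t+1 = subst (2 * q ∣_) (ring V) (*-monoʳ-∣ 2 q∣V+1)
      where
      ring : ∀ v → 2 * (v + 1) ≡ 1 + 2 * v + 1
      ring = solve-∀
    n≈1 : n ≈ 1 [mod 2 * q ]
    n≈1 = ≈-cancelʳ (τ * n) (≈-trans (≈-reflexive (ring τ n))
      (≈-trans (≈-* (∣⇒≈0 2q∣t+1) (≈-refl {x = n})) (≈-sym (≈-trans (≈-reflexive (+-comm 1 (τ * n))) tn+1≈0))))
      where
      ring : ∀ t n → n + t * n ≡ (t + 1) * n
      ring = solve-∀
  by-parity : (∃ λ j → V ≡ 2 * j) ⊎ (∃ λ j → V ≡ 1 + 2 * j) → q * q ≤ τ * n
  -- Of V and V + 1 one is odd, hence prime to q, so q divides the other.
  by-parity (inj₁ (j , V≡)) = plus (coprime-divisor {q} {V + 1}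
    (q-coprime (subst (λ k → ¬ 2 ∣ k) (trans (+-comm 1 _) (cong (_+ 1) (sym V≡))) (2∤1+2* j)))
    (subst (q ∣_) (*-comm V (V + 1)) q∣))
  by-parity (inj₂ (j , V≡)) = minus (coprime-divisor {q} {V}
    (q-coprime (subst (λ k → ¬ 2 ∣ k) (sym V≡) (2∤1+2* j))) q∣)

-- By `no-unit-factor`, t² - 1 = 4V has 2-adic valuation at most m + 2, whereas q² = 2 ^ (2m + 2)
-- divides (t²) ^ X - 1. So 2 ^ m divides the quotient of the latter by t² - 1, and lifting the
-- exponent with w = 2 passes it on to X.
two-power∣half-exponent : ∀ m {q X} → q ≡ 2 ^ suc m → t * n + 1 ≡ q * q → t ≢ 1 → n ≢ 1 →
                          t ^ (2 * X) ≈ 1 [mod q * q ] → 2 ^ m ∣ X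
two-power∣half-exponent {t} {n} m {q} {X} q≡ tn+1≡ t≢1 n≢1 p with odd-factor {t} {n} m q≡ tn+1≡
... | zero , refl = contradiction refl t≢1
... | suc v , refl with two-adic (4 * (suc v * (suc v + 1))) (λ ())
... | l , o , W≡ with l ≤? suc (suc m)
... | no l≰ = contradiction (*-cancelˡ-∣ 4 (∣-trans 4q∣2^l (subst (2 ^ l ∣_) (sym W≡) (m∣m*n (1 + 2 * o)))))
                (no-unit-factor m {v = v} q≡ tn+1≡ n≢1)
  where
  4q∣2^l : 4 * q ∣ 2 ^ l
  4q∣2^l with k , l≡ ← m≤n⇒∃[o]m+o≡n (≰⇒> l≰) =
    subst₂ (λ q z → 4 * q ∣ 2 ^ z) (sym q≡) l≡ (subst (4 * 2 ^ suc m ∣_) (sym (^-distribˡ-+-* 2 (3 + m) k))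
      (∣m⇒∣m*n (2 ^ k) (∣-reflexive (*-assoc 2 2 (2 ^ suc m)))))
... | yes l≤ with r , l+r≡ ← m≤n⇒∃[o]m+o≡n l≤ =
  conclude (≈⇒∣∸ τ^≈1 t^≡) (≈⇒∣∸ p t^≡)
  where
  τ = 1 + 2 * suc v
  V = suc v * (suc v + 1)
  w = proj₁ (suc-of (τ ^ (2 * X)) (≢-nonZero⁻¹ _ {{m^n≢0 τ (2 * X)}}))
  t^≡ = proj₂ (suc-of (τ ^ (2 * X)) (≢-nonZero⁻¹ _ {{m^n≢0 τ (2 * X)}}))
  W = 4 * V
  τ²≡ : τ * τ ≡ 1 + W
  τ²≡ = ring (suc v)
    where
    ring : ∀ v → (1 + 2 * v) * (1 + 2 * v) ≡ 1 + 4 * (v * (v + 1))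
    ring = solve-∀
  τ^≡ : τ ^ (2 * X) ≡ (1 + W) ^ X
  τ^≡ = trans (^-even τ X) (cong (_^ X) τ²≡)
  τ^≈1 : τ ^ (2 * X) ≈ 1 [mod W ]
  τ^≈1 = ≈-trans (≈-reflexive τ^≡) (≈-trans (≈-^ X (≈-+ (≈-refl {x = 1}) (∣⇒≈0 ∣-refl))) (≈-reflexive (^-zeroˡ X)))
  q²≡ : q * q ≡ 2 ^ l * (2 ^ r * 2 ^ m)
  q²≡ = trans (cong₂ _*_ q≡ q≡) (trans (ring (2 ^ m)) (trans (cong (λ k → 2 ^ k * 2 ^ m) (sym l+r≡))
    (trans (cong (_* 2 ^ m) (^-distribˡ-+-* 2 l r)) (*-assoc (2 ^ l) (2 ^ r) (2 ^ m)))))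
    where
    ring : ∀ u → 2 * u * (2 * u) ≡ 2 * (2 * u) * u
    ring = solve-∀
  odd-1+W : ¬ 2 ∣ 1 + W
  odd-1+W = subst (λ k → ¬ 2 ∣ 1 + k) (sym (*-assoc 2 2 V)) (2∤1+2* (2 * V))
  conclude : W ∣ w → q * q ∣ w → 2 ^ m ∣ X
  conclude (divides g w≡) q²∣w = lift (coprime-divisor {2 ^ m} {1 + 2 * o} (coprime-^ˡ m (odd⇒coprime2 (2∤1+2* o)))
    (∣-trans (n∣m*n (2 ^ r)) (*-cancelˡ-∣ (2 ^ l) {{m^n≢0 2 l}} (subst₂ _∣_ q²≡
      (trans w≡ (trans (cong (g *_) W≡) (ring g (2 ^ l) (1 + 2 * o)))) q²∣w))))
    where
    ring : ∀ g l o → g * (l * o) ≡ l * (o * g)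
    ring = solve-∀
    lift : 2 ^ m ∣ g → 2 ^ m ∣ X
    lift (divides i g≡) = lifting-difference m 1 W X i (m∣m*n V) (odd⇒coprime2 odd-1+W) ∣-refl
      (trans (sym τ^≡) (trans t^≡ (cong₂ _+_ (sym (^-zeroˡ X))
        (trans w≡ (trans (*-comm g W) (cong (W *_) (trans g≡ (*-comm i (2 ^ m)))))))))

-- A number not divisible by 4 can absorb only one factor 2.
∣double : ∀ e → ¬ 4 ∣ u → 2 ^ e ∣ u * v → 2 ^ e ∣ 2 * v
∣double {u} {v} e 4∤u p with odd-or-even u
... | inj₂ (j , refl) = ∣n⇒∣m*n 2 (coprime-divisor {2 ^ e} {u} (coprime-^ˡ e (odd⇒coprime2 (2∤1+2* j))) p)
... | inj₁ (j , refl) = coprime-divisor {2 ^ e} {j} (coprime-^ˡ e (odd⇒coprime2 λ 2∣j → 4∤u (*-monoʳ-∣ 2 2∣j)))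
  (subst (2 ^ e ∣_) (ring j v) p)
  where
  ring : ∀ j v → 2 * j * v ≡ j * (2 * v)
  ring = solve-∀

-- With C = T + u the two numbers are C - T and C + T, and their sum 2C is twice an odd number.
¬4∣both : ¬ 2 ∣ T + u → 4 ∣ u → ¬ 4 ∣ u + 2 * T
¬4∣both {T} {u} odd 4∣u 4∣v = odd (*-cancelˡ-∣ 2 (subst (4 ∣_) (ring T u) (∣m∣n⇒∣m+n 4∣u 4∣v)))
  where
  ring : ∀ T u → u + (u + 2 * T) ≡ 2 * (T + u)
  ring = solve-∀

difference-of-squares : T * T + N ≡ (T + u) * (T + u) → N ≡ u * (u + 2 * T)
difference-of-squares {T} {N} {u} eq = +-cancelˡ-≡ (T * T) _ _ (trans eq (ring T u))
  where
  ring : ∀ T u → (T + u) * (T + u) ≡ T * T + u * (u + 2 * T)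
  ring = solve-∀

-- C − T and C + T are not both divisible by 4, so one of them is at least 2 ^ e / 2.
square-gap : ∀ e → ¬ 2 ∣ C → N ≢ 0 → T * T + 2 ^ e * N ≡ C * C → 2 ^ e ≤ 4 * C
square-gap {C} {N} {T} e odd-C N≢0 eq with m≤n⇒∃[o]m+o≡n (<⇒≤ T<C)
  where
  T<C : T < C
  T<C = square-<-cancel (subst (T * T <_) eq (m<m+n (T * T)
    (>-nonZero⁻¹ _ {{m*n≢0 (2 ^ e) N {{m^n≢0 2 e}} {{≢-nonZero N≢0}}}})))
... | zero , refl = contradiction (difference-of-squares {T} {2 ^ e * N} {0} eq)
        (≢-nonZero⁻¹ _ {{m*n≢0 (2 ^ e) N {{m^n≢0 2 e}} {{≢-nonZero N≢0}}}})
... | u@(suc _) , refl with 4 ∣? u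
... | no 4∤u = ≤-trans (∣⇒≤ (∣double e 4∤u (subst (2 ^ e ∣_) N≡ (m∣m*n N))))
        (≤-trans (m≤m+n (2 * (u + 2 * T)) (2 * u)) (≤-reflexive (ring u T)))
  where
  N≡ = difference-of-squares {T} {2 ^ e * N} {u} eq
  ring : ∀ u T → 2 * (u + 2 * T) + 2 * u ≡ 4 * (T + u)
  ring = solve-∀
... | yes 4∣u = ≤-trans (∣⇒≤ (∣double e (¬4∣both {T} odd-C 4∣u)
          (subst (2 ^ e ∣_) (trans N≡ (*-comm u _)) (m∣m*n N))))
        (≤-trans (m≤m+n (2 * u) (2 * (u + 2 * T))) (≤-reflexive (ring u T)))
  where
  N≡ = difference-of-squares {T} {2 ^ e * N} {u} eq
  ring : ∀ u T → 2 * u + 2 * (u + 2 * T) ≡ 4 * (T + u)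
  ring = solve-∀

-- The order of 2 modulo 2 ^ m + 1 is 2m.
half-order : ∀ m z .{{_ : NonZero m}} → 2 ^ z ≈ 1 [mod 2 ^ m + 1 ] →
             ∃ λ Z → z ≡ 2 * Z × (2 ^ Z ≈ 1 [mod 2 ^ m + 1 ] ⊎ 2 ^ Z + 1 ≈ 0 [mod 2 ^ m + 1 ])
-- With z = s m + r and r < m, 2 ^ z ≡ (-1) ^ s 2 ^ r. For odd s, 1 + 2 ^ r would be a multiple of
-- f, but it is too small. For even s, 2 ^ r ≡ 1 forces r = 0, so Z = (s / 2) m and 2 ^ Z ≡ ±1.
half-order m z 2^z≈1 = by-quotient (odd-or-even (z / m))
  where
  r = z % m
  s = z / m
  f = 2 ^ m + 1
  2^r<2^m : 2 ^ r < 2 ^ m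
  2^r<2^m = ^-monoʳ-< 2 ≤-refl (m%n<n z m)
  2^m+1≈0 : 2 ^ m + 1 ≈ 0 [mod f ]
  2^m+1≈0 = ∣⇒≈0 ∣-refl
  2^z≡ : 2 ^ z ≡ 2 ^ r * (2 ^ m) ^ s
  2^z≡ = trans (cong (2 ^_) (m≡m%n+[m/n]*n z m)) (trans (^-distribˡ-+-* 2 r (s * m))
    (cong (2 ^ r *_) (trans (cong (2 ^_) (*-comm s m)) (sym (^-*-assoc 2 m s)))))
  sign : ∀ j → 2 ^ (j * m) ≈ 1 [mod f ] ⊎ 2 ^ (j * m) + 1 ≈ 0 [mod f ]
  sign j with odd-or-even j
  ... | inj₁ (i , refl) = inj₁ (≈-trans (≈-reflexive (trans (cong (2 ^_) (*-comm j m)) (sym (^-*-assoc 2 m j))))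
    (≈-trans (neg-^-even (2 ^ m) 1 i 2^m+1≈0) (≈-reflexive (^-zeroˡ j))))
  ... | inj₂ (i , refl) = inj₂ (≈-trans (≈-+ (≈-reflexive (trans (cong (2 ^_) (*-comm j m)) (sym (^-*-assoc 2 m j))))
    (≈-reflexive (sym (^-zeroˡ j)))) (neg-^-odd (2 ^ m) 1 i 2^m+1≈0))
  by-quotient : (∃ λ j → s ≡ 2 * j) ⊎ (∃ λ j → s ≡ 1 + 2 * j) →
                ∃ λ Z → z ≡ 2 * Z × (2 ^ Z ≈ 1 [mod f ] ⊎ 2 ^ Z + 1 ≈ 0 [mod f ])
  by-quotient (inj₁ (j , s≡)) with suc-of (2 ^ r) (2^≢0 r)
  ... | w , 2^r≡ = j * m , trans (m≡m%n+[m/n]*n z m) (trans (cong₂ _+_ r≡0 (cong (_* m) s≡)) (*-assoc 2 j m)) , sign j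
    where
    2^r≈1 : 2 ^ r ≈ 1 [mod f ]
    2^r≈1 = ≈-trans (≈-trans (≈-reflexive (sym (*-identityʳ (2 ^ r)))) (≈-* (≈-refl {x = 2 ^ r})
      (≈-sym (≈-trans (≈-reflexive (cong ((2 ^ m) ^_) s≡)) (≈-trans (neg-^-even (2 ^ m) 1 j 2^m+1≈0) (≈-reflexive (^-zeroˡ (2 * j))))))))
      (≈-trans (≈-reflexive (sym 2^z≡)) 2^z≈1)
    r≡0 : r ≡ 0
    r≡0 with w ≟ 0
    ... | yes w≡0 = [ (λ p → p) , (λ ()) ]′ (m^n≡1⇒n≡0∨m≡1 2 r (trans 2^r≡ (cong suc w≡0)))
    ... | no w≢0 = contradiction (∣⇒≤ {{≢-nonZero w≢0}} (≈⇒∣∸ 2^r≈1 2^r≡))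
      (<⇒≱ (≤-trans (≤-reflexive (sym 2^r≡)) (≤-trans (<⇒≤ 2^r<2^m) (m≤m+n (2 ^ m) 1))))
  by-quotient (inj₂ (j , s≡)) = contradiction (∣⇒≤ (≈0⇒∣ 1+2^r≈0))
    (<⇒≱ (≤-trans (s≤s 2^r<2^m) (≤-reflexive (+-comm 1 (2 ^ m)))))
    where
    1+2^r≈0 : 1 + 2 ^ r ≈ 0 [mod f ]
    1+2^r≈0 = ≈-trans (≈-+ (≈-sym (≈-trans (≈-reflexive (trans (cong (λ s → 2 ^ r * (2 ^ m) ^ s) (sym s≡)) (sym 2^z≡))) 2^z≈1))
        (≈-reflexive (trans (sym (*-identityʳ (2 ^ r))) (cong (2 ^ r *_) (sym (^-zeroˡ (1 + 2 * j)))))))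
      (≈-trans (≈-reflexive (sym (*-distribˡ-+ (2 ^ r) ((2 ^ m) ^ (1 + 2 * j)) (1 ^ (1 + 2 * j)))))
      (≈-trans (≈-* (≈-refl {x = 2 ^ r}) (neg-^-odd (2 ^ m) 1 j 2^m+1≈0)) (≈-reflexive (*-zeroʳ (2 ^ r)))))

-- c ^ (2Z) − 1 = (c ^ Z − 1)(c ^ Z + 1), and f ^ x divides one factor.
no-large-power : ∀ {f c x Z} → ¬ 2 ∣ f → 3 ≤ f → c ≤ f * f → 2 ≤ c → Z ≢ 0 → 2 * Z < x → f ^ x * N + 1 ≡ c ^ (2 * Z) →
                 ¬ (c ^ Z ≈ 1 [mod f ] ⊎ c ^ Z + 1 ≈ 0 [mod f ])
no-large-power {N} {f} {c} {x} {Z} odd-f 3≤f c≤f² 2≤c Z≢0 2Z<x eq cases with suc-of (c ^ Z) (≢-nonZero⁻¹ _ {{m^n≢0 c Z {{≤-nonZero 2≤c}}}})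
... | w , c^Z≡ = <⇒≱ c^Z+1<f^x (f^x≤ cases)
  where
  open ≤-Reasoning
  instance
    f≢0 : NonZero f
    f≢0 = ≤-nonZero 3≤f
  w≢0 : w ≢ 0
  w≢0 w≡0 = [ Z≢0 , (λ c≡1 → <⇒≢ 2≤c (sym c≡1)) ]′ (m^n≡1⇒n≡0∨m≡1 c Z (trans c^Z≡ (cong suc w≡0)))
  2≤c^Z : 2 ≤ c ^ Z
  2≤c^Z = subst (2 ≤_) (sym c^Z≡) (s≤s (n≢0⇒n>0 w≢0))
  c^Z+1<f^x : c ^ Z + 1 < f ^ x
  c^Z+1<f^x = begin-strict
    c ^ Z + 1          <⟨ +-monoʳ-< (c ^ Z) 2≤c^Z ⟩
    c ^ Z + c ^ Z      ≤⟨ m≤m+n _ (c ^ Z) ⟩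
    c ^ Z + c ^ Z + c ^ Z ≡⟨ ring (c ^ Z) ⟩
    3 * c ^ Z          ≤⟨ *-mono-≤ 3≤f (^-monoˡ-≤ Z c≤f²) ⟩
    f * (f * f) ^ Z    ≡⟨ cong (f *_) (^-even f Z) ⟨
    f ^ suc (2 * Z)    ≤⟨ ^-monoʳ-≤ f 2Z<x ⟩
    f ^ x              ∎
    where
    ring : ∀ u → u + u + u ≡ 3 * u
    ring = solve-∀
  f^x∣ : f ^ x ∣ w * (2 + w)
  f^x∣ = subst (f ^ x ∣_) (+-cancelʳ-≡ 1 _ _ (trans eq (trans (^-square c Z) (trans (cong₂ _*_ c^Z≡ c^Z≡) (ring w)))))
    (m∣m*n N)
    where
    ring : ∀ w → suc w * suc w ≡ w * (2 + w) + 1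
    ring = solve-∀
  -- The factors w and 2 + w are c ^ Z - 1 and c ^ Z + 1. They differ by 2 and f is odd, so f is
  -- prime to one as soon as it divides the other.
  cop : ∀ {i} → i ∣ f → i ∣ 2 → i ≡ 1
  cop i∣f i∣2 = odd⇒coprime2 odd-f (i∣2 , i∣f)
  f^x≤ : c ^ Z ≈ 1 [mod f ] ⊎ c ^ Z + 1 ≈ 0 [mod f ] → f ^ x ≤ c ^ Z + 1
  f^x≤ (inj₁ p) = ≤-trans (∣⇒≤ {{≢-nonZero w≢0}} (coprime-divisor {f ^ x} {2 + w}
      (coprime-^ˡ x λ {i} (i∣f , i∣w+2) → cop i∣f (∣m+n∣m⇒∣n (subst (i ∣_) (+-comm 2 w) i∣w+2) (∣-trans i∣f (≈⇒∣∸ p c^Z≡))))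
      (subst (f ^ x ∣_) (*-comm w (2 + w)) f^x∣)))
    (≤-trans (n≤1+n w) (≤-trans (≤-reflexive (sym c^Z≡)) (m≤m+n _ 1)))
  f^x≤ (inj₂ p) = subst (f ^ x ≤_) 2+w≡ (∣⇒≤ (coprime-divisor {f ^ x} {w}
      (coprime-^ˡ x λ (i∣f , i∣w) → cop i∣f (∣m+n∣m⇒∣n (∣-trans i∣f (subst (f ∣_) (trans (sym 2+w≡) (+-comm 2 w)) (≈0⇒∣ p))) i∣w))
      f^x∣))
    where
    2+w≡ : 2 + w ≡ c ^ Z + 1
    2+w≡ = trans (+-comm 1 (suc w)) (cong (_+ 1) (sym c^Z≡))

^-injectiveʳ : 1 < u → u ^ m ≡ u ^ n → m ≡ n
^-injectiveʳ {u} {m} {n} 1<u eq with <-cmp m n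
... | tri< m<n _ _ = contradiction eq (<⇒≢ (^-monoʳ-< u 1<u m<n))
... | tri≈ _ m≡n _ = m≡n
... | tri> _ _ n<m = contradiction (sym eq) (<⇒≢ (^-monoʳ-< u 1<u n<m))

<⇒∃suc : m < n → ∃ λ i → m + suc i ≡ n
<⇒∃suc {m} m<n with i , eq ← m≤n⇒∃[o]m+o≡n m<n = i , trans (+-suc m i) eq

-- Arithmetic of the triple (q² - 1, 2q, q² + 1).

-- Here k is one less than the index of the Fermat number c.
module Triple (k a : ℕ) (a+1≡q² : a + 1 ≡ 2 ^ (2 ^ k) * 2 ^ (2 ^ k)) where
  m₀ q b c f M : ℕ
  m₀ = 2 ^ k
  q = 2 ^ m₀
  b = 2 * q
  c = a + 2
  f = q + 1
  M = q * q

  pred-m : ℕ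
  pred-m = proj₁ (suc-of m₀ (2^≢0 k))

  m≡ : m₀ ≡ suc pred-m
  m≡ = proj₂ (suc-of m₀ (2^≢0 k))

  instance
    m≢0 : NonZero m₀
    m≢0 = m^n≢0 2 k

  q≡ : q ≡ 2 ^ suc pred-m
  q≡ = cong (2 ^_) m≡

  2∣q : 2 ∣ q
  2∣q = subst (2 ∣_) (sym q≡) (m∣m*n (2 ^ pred-m))

  2≤q : 2 ≤ q
  2≤q = ∣⇒≤ {{m^n≢0 2 m₀}} 2∣q

  3≤a : 3 ≤ a
  3≤a = +-cancelʳ-≤ 1 3 a (≤-trans (*-mono-≤ 2≤q 2≤q) (≤-reflexive (sym a+1≡q²)))

  4≤b : 4 ≤ b
  4≤b = *-monoʳ-≤ 2 2≤q

  3≤f : 3 ≤ f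
  3≤f = +-monoˡ-≤ 1 2≤q

  instance
    a≢0 : NonZero a
    a≢0 = ≤-nonZero 3≤a
    c≢0 : NonZero c
    c≢0 = ≢-nonZero λ p → contradiction (trans (+-comm 2 a) p) λ ()

  2≤c : 2 ≤ c
  2≤c = m≤n+m 2 a

  -- The square b² = 4q² = 4 (a + 1) is what completes a² to (a + 2)².
  pyth : a * a + b * b ≡ c * c
  pyth = trans (trans (cong (a * a +_) (ring q)) (cong (λ s → a * a + 4 * s) (sym a+1≡q²))) (ring′ a)
    where
    ring : ∀ q → 2 * q * (2 * q) ≡ 4 * (q * q)
    ring = solve-∀
    ring′ : ∀ a → a * a + 4 * (a + 1) ≡ (a + 2) * (a + 2)
    ring′ = solve-∀

  c≡M+1 : c ≡ M + 1
  c≡M+1 = trans (sym (+-assoc a 1 1)) (cong (_+ 1) a+1≡q²)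

  odd-+1 : ∀ {u} → 2 ∣ u + 1 → ¬ 2 ∣ u
  odd-+1 p 2∣u = contradiction (∣1⇒≡1 (∣m+n∣m⇒∣n p 2∣u)) λ ()

  2∣M : 2 ∣ M
  2∣M = ∣m⇒∣m*n q 2∣q

  odd-a : ¬ 2 ∣ a
  odd-a = odd-+1 (subst (2 ∣_) (sym a+1≡q²) 2∣M)

  odd-c : ¬ 2 ∣ c
  odd-c p = odd-a (∣m+n∣m⇒∣n (subst (2 ∣_) (+-comm a 2) p) ∣-refl)

  odd-f : ¬ 2 ∣ f
  odd-f p = odd-+1 p 2∣q

  odd-^ : ∀ {u} n → ¬ 2 ∣ u → ¬ 2 ∣ u ^ n
  odd-^ n odd p = contradiction (coprime-^ʳ n (odd⇒coprime2 odd) (∣-refl , p)) λ ()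

  odd⇒coprime-b : ∀ {u} → ¬ 2 ∣ u → Coprime u b
  odd⇒coprime-b odd = coprime-*ʳ (coprime-sym (odd⇒coprime2 odd)) (coprime-^ʳ m₀ (coprime-sym (odd⇒coprime2 odd)))

  coprime-c-a : Coprime c a
  coprime-c-a (i∣c , i∣a) = odd⇒coprime2 odd-a (∣m+n∣m⇒∣n i∣c i∣a , i∣a)

  coprime-c-b : Coprime c b
  coprime-c-b = odd⇒coprime-b odd-c

  -- This is a = (q + 1)(q - 1), written without subtraction as f q = f + a.
  f∣a : f ∣ a
  f∣a = ∣m+n∣m⇒∣n (subst (f ∣_) eq (m∣m*n q)) ∣-refl
    where
    ring : ∀ q → (q + 1) * q ≡ q * q + q
    ring = solve-∀
    ring′ : ∀ a q → a + 1 + q ≡ q + 1 + a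
    ring′ = solve-∀
    eq : f * q ≡ f + a
    eq = trans (ring q) (trans (cong (_+ q) (sym a+1≡q²)) (ring′ a q))

  c≤f² : c ≤ f * f
  c≤f² = ≤-trans (≤-reflexive c≡M+1) (≤-trans (m≤m+n (M + 1) (2 * q)) (≤-reflexive (ring q)))
    where
    ring : ∀ q → q * q + 1 + 2 * q ≡ (q + 1) * (q + 1)
    ring = solve-∀

  b^≡ : ∀ y → b ^ y ≡ 2 ^ (suc m₀ * y)
  b^≡ y = ^-*-assoc 2 (suc m₀) y

  a^≈0 : ∀ N → 1 ≤ x → d ∣ a → a ^ x * N ≈ 0 [mod d ]
  a^≈0 {suc x} N _ d∣a = ∣⇒≈0 (∣m⇒∣m*n N (∣m⇒∣m*n (a ^ x) d∣a))

  c≈2 : d ∣ a → c ≈ 2 [mod d ]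
  c≈2 d∣a = ≈-+ (∣⇒≈0 d∣a) ≈-refl

  b^≈0 : ∀ N → 1 ≤ y → d ∣ b → b ^ y * N ≈ 0 [mod d ]
  b^≈0 {suc y} N _ d∣b = ∣⇒≈0 (∣m⇒∣m*n N (∣m⇒∣m*n (b ^ y) d∣b))

  M∣b^ : 2 ≤ y → M ∣ b ^ y
  M∣b^ {suc (suc y)} _ = subst (M ∣_) (*-assoc b b (b ^ y)) (∣m⇒∣m*n (b ^ y)
    (*-pres-∣ {q} {b} {q} {b} (n∣m*n 2) (n∣m*n 2)))
  M∣b^ {suc zero} (s≤s ())

  q+1≈0 : q + 1 ≈ 0 [mod f ]
  q+1≈0 = ∣⇒≈0 ∣-refl

  b+2≈0 : b + 2 ≈ 0 [mod f ]
  b+2≈0 = ∣⇒≈0 (subst (f ∣_) (ring q) (n∣m*n 2))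
    where
    ring : ∀ q → 2 * (q + 1) ≡ 2 * q + 2
    ring = solve-∀

  odd∤2^ : ∀ n → 3 ≤ d → ¬ 2 ∣ d → ¬ d ∣ 2 ^ n
  odd∤2^ n 3≤d odd p = <⇒≢ (<⇒≤ 3≤d) (sym (odd∣2^⇒≡1 n odd p))

  -- Impossible orders of x, y, z for n > 1, and the mod 4 obstruction.

  no-z≡y<x : 1 ≤ y → y < x → a ^ x * N + b ^ y ≡ c ^ y → ⊥
  no-z≡y<x {y} {x} {N} 1≤y y<x eq with odd-or-even y
  ... | inj₁ (zero , refl) = contradiction 1≤y λ ()
  ... | inj₁ (suc j , refl) = even-exponent-bound {u = a} {v = b} pyth (coprime-sym coprime-c-a) (<⇒≤ 3≤a) y<x eq
  -- Modulo f, b ≡ -2 and c ≡ 2. For odd y this gives -2 ^ y ≡ 2 ^ y, so the odd number f would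
  -- divide 2 ^ (y + 1).
  ... | inj₂ (j , refl) = odd∤2^ (suc y) 3≤f odd-f (≈0⇒∣ (≈-trans
      (≈-+ (≈-sym b^≈2^) (≈-reflexive (+-identityʳ (2 ^ y)))) (neg-^-odd b 2 j b+2≈0)))
    where
    b^≈2^ : b ^ y ≈ 2 ^ y [mod f ]
    b^≈2^ = ≈-trans (≈-+ (≈-sym (a^≈0 N (≤-trans (s≤s z≤n) y<x) f∣a)) ≈-refl)
      (≈-trans (≈-reflexive eq) (≈-^ y (c≈2 f∣a)))

  4∣b : 4 ∣ b
  4∣b = *-monoʳ-∣ 2 2∣q

  4∣M : 4 ∣ M
  4∣M = *-pres-∣ 2∣q 2∣q

  a+1≈0 : d ∣ M → a + 1 ≈ 0 [mod d ]
  a+1≈0 {d} d∣M = ∣⇒≈0 (subst (d ∣_) (sym a+1≡q²) d∣M)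

  c≈1 : d ∣ M → c ≈ 1 [mod d ]
  c≈1 d∣M = ≈-trans (≈-reflexive c≡M+1) (≈-+ (∣⇒≈0 d∣M) ≈-refl)

  c^≈1 : ∀ z → d ∣ M → c ^ z ≈ 1 [mod d ]
  c^≈1 z d∣M = ≈-trans (≈-^ z (c≈1 d∣M)) (≈-reflexive (^-zeroˡ z))

  -- Modulo 4, a ≡ -1, b ≡ 0 and c ≡ 1. The factor N lets the lemma serve both n = 1 and x = z < y.
  odd-a-exponent : ∀ N z j → 1 ≤ y → ¬ a ^ (1 + 2 * j) + b ^ y * N ≡ c ^ z
  odd-a-exponent {y} N z j 1≤y eq = 2<⇒2≉0 {4} (s≤s (s≤s (s≤s z≤n)))
    (≈-trans (≈-+ (≈-sym a^≈1) (≈-reflexive (sym (^-zeroˡ (1 + 2 * j))))) (neg-^-odd a 1 j (a+1≈0 4∣M)))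
    where
    a^≈1 : a ^ (1 + 2 * j) ≈ 1 [mod 4 ]
    a^≈1 = ≈-trans (≈-reflexive (sym (+-identityʳ _)))
      (≈-trans (≈-+ (≈-refl {x = a ^ (1 + 2 * j)}) (≈-sym (b^≈0 N 1≤y 4∣b)))
      (≈-trans (≈-reflexive eq) (c^≈1 z 4∣M)))

  no-z≡x<y : 1 ≤ x → x < y → a ^ x + b ^ y * N ≡ c ^ x → ⊥
  no-z≡x<y {x} {y} {N} 1≤x x<y eq with odd-or-even x
  ... | inj₁ (zero , refl) = contradiction 1≤x λ ()
  ... | inj₁ (suc j , refl) = even-exponent-bound {u = b} {v = a} (trans (+-comm (b * b) (a * a)) pyth) (coprime-sym coprime-c-b)
          (<⇒≤ (<⇒≤ 4≤b)) x<y (trans (+-comm _ (a ^ x)) eq)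
  ... | inj₂ (j , refl) = odd-a-exponent N x j (≤-trans (s≤s z≤n) x<y) eq

  -- `t` is the cofactor of n ^ (z - y) in b ^ y, so n and t are powers of 2. As n ≠ 1 is even and c
  -- ^ z is odd, t is odd and therefore 1.
  no-y<z<x : ∀ i l → n ≢ 1 → 1 ≤ z → z < x → b ^ y ≡ t * n ^ suc l → a ^ x * n ^ suc i + t ≡ c ^ z → ⊥
  no-y<z<x {n} {z} {x} {y} {t} i l n≢1 1≤z z<x b^y≡ eq = conclude (half-order m₀ z 2^z≈1)
    where
    n∣b^y : n ∣ 2 ^ (suc m₀ * y)
    n∣b^y = subst (n ∣_) (trans (sym b^y≡) (b^≡ y)) (∣n⇒∣m*n t (m∣m*n (n ^ l)))
    t∣b^y : t ∣ 2 ^ (suc m₀ * y)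
    t∣b^y = subst (t ∣_) (trans (sym b^y≡) (b^≡ y)) (m∣m*n (n ^ suc l))
    2∣n : 2 ∣ n
    2∣n with 2 ∣? n
    ... | yes p = p
    ... | no p = contradiction (odd∣2^⇒≡1 (suc m₀ * y) p n∣b^y) n≢1
    odd-t : ¬ 2 ∣ t
    odd-t 2∣t = odd-^ z odd-c (subst (2 ∣_) eq (∣m∣n⇒∣m+n (∣n⇒∣m*n (a ^ x) (∣m⇒∣m*n (n ^ i) 2∣n)) 2∣t))
    t≡1 : t ≡ 1
    t≡1 = odd∣2^⇒≡1 (suc m₀ * y) odd-t t∣b^y
    f∣a^ : f ^ x ∣ a ^ x
    f∣a^ = divides-pow f∣a
      where
      divides-pow : d ∣ e → d ^ x ∣ e ^ x
      divides-pow (divides g refl) = divides (g ^ x) (*-^ g _ x)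
    2^z≈1 : 2 ^ z ≈ 1 [mod f ]
    2^z≈1 = ≈-trans (≈-sym (≈-^ z (c≈2 f∣a))) (≈-trans (≈-reflexive (sym eq))
      (≈-+ (a^≈0 (n ^ suc i) (≤-trans (s≤s z≤n) z<x) f∣a) (≈-reflexive t≡1)))
    conclude : (∃ λ Z → z ≡ 2 * Z × (2 ^ Z ≈ 1 [mod f ] ⊎ 2 ^ Z + 1 ≈ 0 [mod f ])) → ⊥
    conclude (Z , refl , cases) with divides g a^≡ ← f∣a^ =
      no-large-power {N = g * n ^ suc i} {Z = Z} odd-f 3≤f c≤f² 2≤c (λ { refl → contradiction 1≤z λ () }) z<x
        (trans (cong₂ _+_ (trans (ring (f ^ x) g (n ^ suc i)) (cong (_* n ^ suc i) (sym a^≡))) (sym t≡1)) eq)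
        (transfer cases)
      where
      ring : ∀ f g n → f * (g * n) ≡ g * f * n
      ring = solve-∀
      c^Z≈2^Z : c ^ Z ≈ 2 ^ Z [mod f ]
      c^Z≈2^Z = ≈-^ Z (c≈2 f∣a)
      transfer : 2 ^ Z ≈ 1 [mod f ] ⊎ 2 ^ Z + 1 ≈ 0 [mod f ] → c ^ Z ≈ 1 [mod f ] ⊎ c ^ Z + 1 ≈ 0 [mod f ]
      transfer (inj₁ p) = inj₁ (≈-trans c^Z≈2^Z p)
      transfer (inj₂ p) = inj₂ (≈-trans (≈-+ c^Z≈2^Z ≈-refl) p)

  -- By `square-gap`, b ^ y ≤ 4 c ^ Z. But c = q² + 1 < b² and 4 ≤ b give 4 c ^ Z < b ^ (2Z + 1) ≤ b
  -- ^ y.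
  no-square-gap : ∀ Z → Z ≢ 0 → 2 * Z < y → N ≢ 0 → T * T + b ^ y * N ≡ c ^ (2 * Z) → ⊥
  no-square-gap {y} {N} {T} Z Z≢0 2Z<y N≢0 eq = <⇒≱ gap (square-gap {T = T} (suc m₀ * y) (odd-^ Z odd-c) N≢0
      (trans (cong (λ s → T * T + s * N) (sym (b^≡ y))) (trans eq (^-square c Z))))
    where
    open ≤-Reasoning
    c<b² : c < b * b
    c<b² = subst (c <_) (trans (cong (λ s → 4 * s) a+1≡q²) (ring q))
      (≤-trans (+-monoʳ-≤ (suc a) (≤-trans (s≤s (s≤s z≤n)) (m≤n+m 3 (3 * a)))) (≤-reflexive (ring′ a)))
      where
      ring : ∀ q → 4 * (q * q) ≡ 2 * q * (2 * q)
      ring = solve-∀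
      ring′ : ∀ a → suc a + (3 * a + 3) ≡ 4 * (a + 1)
      ring′ = solve-∀
    gap : 4 * c ^ Z < 2 ^ (suc m₀ * y)
    gap = begin-strict
      4 * c ^ Z         <⟨ *-monoʳ-< 4 (^-monoˡ-< Z {{≢-nonZero Z≢0}} c<b²) ⟩
      4 * (b * b) ^ Z   ≤⟨ *-monoˡ-≤ ((b * b) ^ Z) 4≤b ⟩
      b * (b * b) ^ Z   ≡⟨ cong (b *_) (^-even b Z) ⟨
      b ^ suc (2 * Z)   ≤⟨ ^-monoʳ-≤ b {{≤-nonZero 4≤b}} 2Z<y ⟩
      b ^ y             ≡⟨ b^≡ y ⟩
      2 ^ (suc m₀ * y)   ∎

  M≡2^ : M ≡ 2 ^ (m₀ + m₀)
  M≡2^ = sym (^-distribˡ-+-* 2 m₀ m₀)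

  -- `t` is the cofactor of n ^ (z - x) in a ^ x. A common divisor of t and n divides both c ^ z and
  -- a ^ x, so t is prime to n; hence t = r ^ x and n ^ (z - x) = s ^ x with r s = a.
  no-x<z<y : ∀ j l → n ≢ 0 → n ≢ 1 → 1 ≤ x → x < z → z < y →
             a ^ x ≡ t * n ^ suc l → t + b ^ y * n ^ suc j ≡ c ^ z → ⊥
  no-x<z<y {n} {x@(suc x₀)} {z} {y} {t} j l n≢0 n≢1 _ x<z z<y a^x≡ eq =
    with-root (coprime-root x₀ coprime-t (sym a^x≡))
    where
    1≤z : 1 ≤ z
    1≤z = ≤-trans (s≤s z≤n) x<z
    n∣a^x : n ∣ a ^ x
    n∣a^x = subst (n ∣_) (sym a^x≡) (∣n⇒∣m*n t (m∣m*n (n ^ l)))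
    coprime-t : Coprime t (n ^ suc l)
    coprime-t = coprime-^ʳ (suc l) λ (i∣t , i∣n) →
      coprime-^ʳ x (coprime-^ˡ z coprime-c-a)
        (subst (_ ∣_) eq (∣m∣n⇒∣m+n i∣t (∣n⇒∣m*n (b ^ y) (∣m⇒∣m*n (n ^ j) i∣n))) , ∣-trans i∣n n∣a^x)
    t≈1 : t ≈ 1 [mod M ]
    t≈1 = ≈-trans (≈-reflexive (sym (+-identityʳ t)))
      (≈-trans (≈-+ (≈-refl {x = t}) (≈-sym (∣⇒≈0 (∣m⇒∣m*n (n ^ suc j) (M∣b^ (≤-trans (s≤s 1≤z) z<y))))))
      (≈-trans (≈-reflexive eq) (c^≈1 z ∣-refl)))
    n^≢0 : n ^ suc j ≢ 0
    n^≢0 p = n≢0 (m^n≡0⇒m≡0 n (suc j) p)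
    with-root : (∃₂ λ r s → r * s ≡ a × t ≡ r ^ x × n ^ suc l ≡ s ^ x) → ⊥
    with-root (r , s , rs≡a , t≡ , n^≡) = by-parities (odd-or-even z) (odd-or-even x)
      where
      rs+1≡ : r * s + 1 ≡ M
      rs+1≡ = trans (cong (_+ 1) rs≡a) a+1≡q²
      s≢1 : s ≢ 1
      s≢1 refl = n≢1 (m*n≡1⇒m≡1 n (n ^ l) (trans n^≡ (^-zeroˡ x)))
      instance
        s≢0 : NonZero s
        s≢0 = ≢-nonZero λ { refl → ≢-nonZero⁻¹ a (trans (sym rs≡a) (*-zeroʳ r)) }
      r^≈1 : ∀ {k} → x ≡ k → r ^ k ≈ 1 [mod M ]
      r^≈1 refl = ≈-trans (≈-reflexive (sym t≡)) t≈1
      r≡1 : ∀ X → x ≡ 1 + 2 * X → r ≡ 1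
      r≡1 X x≡ with odd-factor {r} {s} pred-m q≡ rs+1≡
      ... | v , refl = cong (λ v → 1 + 2 * v) (odd-root-of-unity (m₀ + m₀) v X
        (subst (r <_) M≡2^ (<-≤-trans (s≤s (≤-trans (m≤m*n r s) (≤-reflexive rs≡a)))
          (≤-reflexive (trans (+-comm 1 a) a+1≡q²))))
        (subst (λ M → r ^ (1 + 2 * X) ≈ 1 [mod M ]) M≡2^ (r^≈1 x≡)))
      t≡1 : r ≡ 1 → t ≡ 1
      t≡1 r≡1 = trans t≡ (trans (cong (_^ x) r≡1) (^-zeroˡ x))
      -- Modulo e, n vanishes and c ≡ 2, so t ≡ 2 ^ z. Raising to the power 2 ^ i replaces 2 by 2 ^
      -- 2 ^ i ≡ -1, and odd z preserves the sign.
      z-odd : ∀ j → z ≡ 1 + 2 * j → ∃₂ λ i e → i ≤ k × 3 ≤ e × e ∣ 2 ^ (2 ^ i) + 1 × t ^ (2 ^ i) + 1 ≈ 0 [mod e ]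
      z-odd h z≡ with fermat-common-divisor (suc k) a+1≡ (gcd[m,n]∣n n a) gcd≢1
        where
        a+1≡ : a + 1 ≡ 2 ^ (2 ^ suc k)
        a+1≡ = trans a+1≡q² (sym (^-square 2 (2 ^ k)))
        gcd≢1 : gcd n a ≢ 1
        gcd≢1 p = n≢1 (coprime-^ʳ x (gcd≡1⇒coprime p) (∣-refl , n∣a^x))
      ... | i , e , s≤s i≤k , e≢1 , e∣gcd , e∣F = i , e , i≤k , odd⇒≥3 (λ 2∣e → odd-a (∣-trans 2∣e e∣a)) e≢1 , e∣F ,
        ≈-trans (≈-+ (≈-trans (≈-^ (2 ^ i) t≈2^z) (≈-reflexive powers)) (≈-reflexive (sym (^-zeroˡ (1 + 2 * h)))))
          (neg-^-odd (2 ^ (2 ^ i)) 1 h (∣⇒≈0 e∣F))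
        where
        e∣a = ∣-trans e∣gcd (gcd[m,n]∣n n a)
        e∣n = ∣-trans e∣gcd (gcd[m,n]∣m n a)
        t≈2^z : t ≈ 2 ^ z [mod e ]
        t≈2^z = ≈-trans (≈-reflexive (sym (+-identityʳ t)))
          (≈-trans (≈-+ (≈-refl {x = t}) (≈-sym (∣⇒≈0 (∣n⇒∣m*n (b ^ y) (∣m⇒∣m*n (n ^ j) e∣n)))))
          (≈-trans (≈-reflexive eq) (≈-^ z (c≈2 e∣a))))
        powers : (2 ^ z) ^ (2 ^ i) ≡ (2 ^ (2 ^ i)) ^ (1 + 2 * h)
        powers = trans (^-*-assoc 2 z (2 ^ i)) (trans (cong (2 ^_) (trans (*-comm z (2 ^ i)) (cong (2 ^ i *_) z≡)))
          (sym (^-*-assoc 2 (2 ^ i) (1 + 2 * h))))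
      z-odd-t≢1 : ∀ h → z ≡ 1 + 2 * h → t ≢ 1
      z-odd-t≢1 h z≡ t≡1 with i , e , _ , 3≤e , _ , p ← z-odd h z≡ =
        2<⇒2≉0 3≤e (≈-trans (≈-+ (≈-reflexive (sym (trans (cong (_^ (2 ^ i)) t≡1) (^-zeroˡ (2 ^ i))))) ≈-refl) p)
      by-parities : (∃ λ h → z ≡ 2 * h) ⊎ (∃ λ h → z ≡ 1 + 2 * h) → (∃ λ X → x ≡ 2 * X) ⊎ (∃ λ X → x ≡ 1 + 2 * X) → ⊥
      by-parities (inj₁ (Z , refl)) x-parity = no-square-gap {T = proj₁ root} Z (λ { refl → contradiction 1≤z λ () }) z<y n^≢0
          (trans (cong (_+ b ^ y * n ^ suc j) (sym (proj₂ root))) eq)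
        where
        -- t is a square for either parity of x, since odd x forces r = 1.
        square-root : (∃ λ X → x ≡ 2 * X) ⊎ (∃ λ X → x ≡ 1 + 2 * X) → ∃ λ T → t ≡ T * T
        square-root (inj₁ (X , x≡)) = r ^ X , trans t≡ (trans (cong (r ^_) x≡) (^-square r X))
        square-root (inj₂ (X , x≡)) = 1 , t≡1 (r≡1 X x≡)
        root = square-root x-parity
      by-parities (inj₂ (h , z≡)) (inj₂ (X , x≡)) = z-odd-t≢1 h z≡ (t≡1 (r≡1 X x≡))
      by-parities (inj₂ (h , z≡)) (inj₁ (X , x≡)) with r ≟ 1
      ... | yes r≡1 = z-odd-t≢1 h z≡ (t≡1 r≡1)
      -- Now x = g q, so t = (r ^ g) ^ q and (r ^ g) ^ 2 ^ (m₀ + i) ≡ -1 modulo e. `order-bound`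
      -- demands e ≥ 2 ^ (m₀ + i + 1) ≥ 2q, but e ≤ q + 1.
      ... | no r≢1 with i , e , i≤k , 3≤e , e∣F , p ← z-odd h z≡
                      | divides g X≡ ← two-power∣half-exponent {r} {s} pred-m {X = X} q≡ rs+1≡ r≢1 s≢1 (r^≈1 x≡) =
        <⇒≱ e<2^ (order-bound (m₀ + i) 3≤e (≈-trans (≈-reflexive (cong (_+ 1) (powers g X≡))) p))
        where
        open ≤-Reasoning
        ring : ∀ g u → 2 * (g * u) ≡ g * (2 * u)
        ring = solve-∀
        powers : ∀ g → X ≡ g * 2 ^ pred-m → (r ^ g) ^ (2 ^ (m₀ + i)) ≡ t ^ (2 ^ i)
        powers g X≡ = trans (cong ((r ^ g) ^_) (^-distribˡ-+-* 2 m₀ i)) (trans (sym (^-*-assoc (r ^ g) q (2 ^ i)))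
          (cong (_^ (2 ^ i)) (trans (^-*-assoc r g q) (trans (cong (r ^_) (trans (cong (g *_) q≡)
            (trans (sym (ring g (2 ^ pred-m))) (trans (cong (2 *_) (sym X≡)) (sym x≡))))) (sym t≡)))))
        e<2^ : e < 2 ^ suc (m₀ + i)
        e<2^ = begin-strict
          e                  ≤⟨ ∣⇒≤ {{≢-nonZero λ p → contradiction (trans (+-comm 1 _) p) λ ()}} e∣F ⟩
          2 ^ (2 ^ i) + 1    ≤⟨ +-monoˡ-≤ 1 (^-monoʳ-≤ 2 (^-monoʳ-≤ 2 i≤k)) ⟩
          q + 1              <⟨ +-monoʳ-< q 2≤q ⟩
          q + q              ≡⟨ cong (q +_) (+-identityʳ q) ⟨
          2 ^ suc m₀         ≤⟨ ^-monoʳ-≤ 2 (s≤s (m≤m+n m₀ i)) ⟩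
          2 ^ suc (m₀ + i)   ∎

  -- Taking out the smaller power of n leaves a pure power of a or b plus a multiple of n. A common
  -- divisor of n, c and this cofactor divides that pure power, to which c is prime. For i = j both
  -- summands are free of n and the argument breaks down.
  no-z<min-distinct : ∀ i j → i ≢ j → n ≢ 0 → n ≢ 1 → z < x → z < y → a ^ x * n ^ suc i + b ^ y * n ^ suc j ≡ c ^ z → ⊥
  no-z<min-distinct {n} {z} {x} {y} i j i≢j n≢0 n≢1 z<x z<y eq with <-cmp i j
  ... | tri≈ _ i≡j _ = i≢j i≡j
  ... | tri< i<j _ _ with h , refl ← m≤n⇒∃[o]m+o≡n i<j =
    cofactor-bound {i = i} odd-c refl 3≤a n≢1 (trans factor eq) z<x (m≤m+n (a ^ x) _)
      λ d∣n d∣c {e} (e∣d , e∣S) → coprime-^ʳ x coprime-c-a (∣-trans e∣d d∣c ,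
        ∣m+n∣m⇒∣n (subst (e ∣_) (+-comm (a ^ x) _) e∣S) (∣n⇒∣m*n (b ^ y) (∣m⇒∣m*n (n ^ h) (∣-trans e∣d d∣n))))
    where
    ring : ∀ a b n u v → n * u * (a + b * (n * v)) ≡ a * (n * u) + b * (n * (n * (u * v)))
    ring = solve-∀
    factor : n ^ suc i * (a ^ x + b ^ y * n ^ suc h) ≡ a ^ x * n ^ suc i + b ^ y * n ^ suc (suc i + h)
    factor = trans (ring (a ^ x) (b ^ y) n (n ^ i) (n ^ h))
      (cong (λ s → a ^ x * n ^ suc i + b ^ y * (n * (n * s))) (sym (^-distribˡ-+-* n i h)))
  ... | tri> _ _ j<i with h , refl ← m≤n⇒∃[o]m+o≡n j<i =
    cofactor-bound {i = j} odd-c refl 3≤a n≢1 (trans factor eq) z<x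
      (≤-trans (m≤m*n (a ^ x) (n ^ suc h) {{m^n≢0 n (suc h) {{≢-nonZero n≢0}}}}) (m≤m+n _ (b ^ y)))
      λ d∣n d∣c (e∣d , e∣S) → coprime-^ʳ y coprime-c-b (∣-trans e∣d d∣c ,
        ∣m+n∣m⇒∣n e∣S (∣n⇒∣m*n (a ^ x) (∣m⇒∣m*n (n ^ h) (∣-trans e∣d d∣n))))
    where
    ring : ∀ a b n u v → n * u * (a * (n * v) + b) ≡ a * (n * (n * (u * v))) + b * (n * u)
    ring = solve-∀
    factor : n ^ suc j * (a ^ x * n ^ suc h + b ^ y) ≡ a ^ x * n ^ suc (suc j + h) + b ^ y * n ^ suc j
    factor = trans (ring (a ^ x) (b ^ y) n (n ^ j) (n ^ h))
      (cong (λ s → a ^ x * (n * (n * s)) + b ^ y * n ^ suc j) (sym (^-distribˡ-+-* n j h)))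

  no-z<x≡y : ∀ i → z < x → a ^ x * n ^ suc i + b ^ x * n ^ suc i ≡ c ^ z → ⊥
  no-z<x≡y {z} {x} {n} i z<x eq = power-sum∤ odd-c pyth coprime-c-a coprime-c-b 3≤a (<⇒≤ 4≤b) z<x
    (subst (a ^ x + b ^ x ∣_) (trans (*-distribʳ-+ (n ^ suc i) (a ^ x) (b ^ x)) eq) (m∣m*n (n ^ suc i)))

  -- The primitive equation, n = 1.

  a²≈1 : a * a ≈ 1 [mod 2 * M ]
  a²≈1 = ≈-cancelʳ (2 * M) (≈-trans (≈-reflexive (trans (cong (λ s → a * a + 2 * s) (sym a+1≡q²))
      (trans (ring a) (cong (λ s → s * s + 1) a+1≡q²))))
    (≈-trans (≈-+ (∣⇒≈0 (*-monoˡ-∣ M 2∣M)) ≈-refl) (≈-+ (≈-refl {x = 1}) (≈-sym (∣⇒≈0 ∣-refl)))))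
    where
    ring : ∀ a → a * a + 2 * (a + 1) ≡ (a + 1) * (a + 1) + 1
    ring = solve-∀

  -- The modulus 2q² detects the parity of z: c ≡ q² + 1 differs from 1 there, while its square does
  -- not.
  c²≈1 : c * c ≈ 1 [mod 2 * M ]
  c²≈1 = ≈-trans (≈-reflexive (trans (cong₂ _*_ c≡M+1 c≡M+1) (ring M)))
    (≈-+ (∣⇒≈0 (∣m∣n⇒∣m+n (*-monoˡ-∣ M 2∣M) ∣-refl)) ≈-refl)
    where
    ring : ∀ M → (M + 1) * (M + 1) ≡ M * M + 2 * M + 1
    ring = solve-∀

  a^even≈1 : ∀ j → a ^ (2 * j) ≈ 1 [mod 2 * M ]
  a^even≈1 j = ≈-trans (≈-reflexive (^-even a j)) (≈-trans (≈-^ j a²≈1) (≈-reflexive (^-zeroˡ j)))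

  2M∤M : ¬ 2 * M ∣ M
  2M∤M p = <⇒≱ (m<m+n M (≤-trans M>0 (m≤m+n M 0))) (∣⇒≤ {{>-nonZero M>0}} p)
    where
    M>0 : 0 < M
    M>0 = ≤-trans (s≤s z≤n) (*-mono-≤ 2≤q 2≤q)

  odd-c-exponent : ∀ h j → 1 ≤ j → 1 ≤ y → ¬ a ^ (2 * j) + b ^ y ≡ c ^ (1 + 2 * h)
  -- For y ≥ 2, b ^ y is a multiple of b² = 4q², so the equation reads 1 ≡ q² + 1 modulo 2q².
  odd-c-exponent {suc (suc y)} h j _ _ eq = 2M∤M (≈0⇒∣ (≈-cancelʳ 1 (≈-trans (≈-sym (≈-trans (≈-reflexive eq) c^≈))
    (≈-trans (≈-+ (a^even≈1 j) b^≈) ≈-refl))))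
    where
    c^≈ : c ^ (1 + 2 * h) ≈ M + 1 [mod 2 * M ]
    c^≈ = ≈-trans (≈-* (≈-reflexive c≡M+1) (≈-trans (≈-reflexive (^-even c h)) (≈-trans (≈-^ h c²≈1) (≈-reflexive (^-zeroˡ h)))))
      (≈-reflexive (*-identityʳ (M + 1)))
    ring : ∀ q → 2 * q * (2 * q) ≡ 2 * (2 * (q * q))
    ring = solve-∀
    b^≈ : b ^ suc (suc y) ≈ 0 [mod 2 * M ]
    b^≈ = ∣⇒≈0 (subst (2 * M ∣_) (*-assoc b b (b ^ y)) (∣m⇒∣m*n (b ^ y)
      (subst (2 * M ∣_) (sym (ring q)) (n∣m*n 2))))
  -- For y = 1, q² ∣ b = 2q forces q = 2 and f = 3. Then 2 ≡ -1 modulo f gives b ≡ 2 ^ z ≡ -1,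
  -- against b ≡ -2.
  odd-c-exponent {suc zero} h j 1≤j _ eq = <⇒≢ (<⇒≤ 3≤f) (sym (∣1⇒≡1 (≈0⇒∣ 1≈0)))
    where
    b≈0 : b ≈ 0 [mod M ]
    b≈0 = ≈-trans (≈-reflexive (sym (*-identityʳ b))) (≈-cancelʳ 1 (≈-trans (≈-+ (≈-refl {x = b ^ 1})
      (≈-sym (≈-weaken (n∣m*n 2) (a^even≈1 j))))
      (≈-trans (≈-reflexive (trans (+-comm (b ^ 1) _) eq)) (c^≈1 (1 + 2 * h) ∣-refl))))
    q≡2 : q ≡ 2
    q≡2 = ≤-antisym (*-cancelʳ-≤ q 2 q {{≤-nonZero 2≤q}} (∣⇒≤ {{≤-nonZero 4≤b}} (≈0⇒∣ b≈0))) 2≤q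
    b+1≈0 : b + 1 ≈ 0 [mod f ]
    b+1≈0 = ≈-trans (≈-+ (≈-trans (≈-trans (≈-reflexive (sym (*-identityʳ b)))
        (≈-+ (≈-sym (≈-trans (≈-reflexive (sym (*-identityʳ _))) (a^≈0 {x = 2 * j} 1 (≤-trans 1≤j (m≤m+n j _)) f∣a))) (≈-refl {x = b ^ 1})))
        (≈-trans (≈-reflexive eq) (≈-^ (1 + 2 * h) (c≈2 f∣a)))) (≈-reflexive (sym (^-zeroˡ (1 + 2 * h)))))
      (neg-^-odd 2 1 h (subst (λ q → q + 1 ≈ 0 [mod f ]) q≡2 q+1≈0))
    1≈0 : 1 ≈ 0 [mod f ]
    1≈0 = ≈-trans (≈-+ (≈-sym b+1≈0) (≈-refl {x = 1})) (≈-trans (≈-reflexive (+-assoc b 1 1)) b+2≈0)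

  -- c ^ Z − a ^ X = 2, so a ^ X + 1 is a power of 2; modulo 2q² it is a + 1 = q².
  even-exponents : ∀ X Z → X ≢ 0 → a ^ X * a ^ X + b ^ y ≡ c ^ Z * c ^ Z → X ≡ 1 × Z ≡ 1
  even-exponents {y} X Z X≢0 eq = from-gap (m≤n⇒∃[o]m+o≡n (<⇒≤ T<C))
    where
    P = a ^ X
    T<C : P < c ^ Z
    T<C = square-<-cancel (subst (P * P <_) eq (m<m+n (P * P) (m^n>0 b {{≤-nonZero 4≤b}} y)))
    3≤P : 3 ≤ P
    3≤P = ≤-trans 3≤a (≤-trans (≤-reflexive (sym (*-identityʳ a))) (^-monoʳ-≤ a (n≢0⇒n>0 X≢0)))
    from-two : P + 2 ≡ c ^ Z → (∃ λ j → P + 1 ≡ 2 ^ j) → X ≡ 1 × Z ≡ 1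
    from-two P+2≡ (j , P+1≡) = by-parity (odd-or-even X)
      where
      Z≡1 : X ≡ 1 → Z ≡ 1
      Z≡1 X≡1 = ^-injectiveʳ {c} 2≤c (trans (sym P+2≡) (trans (cong (λ X → a ^ X + 2) X≡1)
        (trans (cong (_+ 2) (*-identityʳ a)) (sym (*-identityʳ c)))))
      by-parity : (∃ λ h → X ≡ 2 * h) ⊎ (∃ λ h → X ≡ 1 + 2 * h) → X ≡ 1 × Z ≡ 1
      -- An even X gives P ≡ 1 ≡ c ^ Z modulo 4, incompatible with P + 2 = c ^ Z.
      by-parity (inj₁ (h , X≡)) = ⊥-elim (2<⇒2≉0 {4} (s≤s (s≤s (s≤s z≤n))) (≈-cancelʳ 1
        (≈-trans (≈-trans (≈-reflexive (+-comm 2 1)) (≈-+ (≈-sym P≈1) (≈-refl {x = 2})))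
          (≈-trans (≈-reflexive P+2≡) (c^≈1 Z 4∣M)))))
        where
        P≈1 : P ≈ 1 [mod 4 ]
        P≈1 = ≈-trans (≈-reflexive (cong (a ^_) X≡)) (≈-trans (neg-^-even a 1 h (a+1≈0 4∣M)) (≈-reflexive (^-zeroˡ (2 * h))))
      by-parity (inj₂ (h , X≡)) with j ≤? m₀ + m₀
      ... | no j≰ = ⊥-elim (2M∤M (subst (2 * M ∣_) a+1≡q² (≈0⇒∣ (≈-trans (≈-+ (≈-sym P≈a) (≈-refl {x = 1})) (∣⇒≈0 2M∣P+1)))))
        where
        P≈a : P ≈ a [mod 2 * M ]
        P≈a = ≈-trans (≈-reflexive (cong (a ^_) X≡)) (≈-trans (≈-* (≈-refl {x = a}) (a^even≈1 h)) (≈-reflexive (*-identityʳ a)))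
        2M∣P+1 : 2 * M ∣ P + 1
        2M∣P+1 with i , refl ← m≤n⇒∃[o]m+o≡n (≰⇒> j≰) = subst₂ _∣_ (cong (2 *_) (sym M≡2^))
          (trans (sym (^-distribˡ-+-* 2 (suc (m₀ + m₀)) i)) (sym P+1≡)) (m∣m*n (2 ^ i))
      ... | yes j≤ = X≡1 , Z≡1 X≡1
        where
        P≤a : P ≤ a
        P≤a = +-cancelʳ-≤ 1 P a (≤-trans (≤-reflexive P+1≡) (≤-trans (^-monoʳ-≤ 2 j≤)
          (≤-reflexive (trans (sym M≡2^) (sym a+1≡q²)))))
        X≡1 : X ≡ 1
        X≡1 = ≤-antisym (≮⇒≥ λ 1<X → <⇒≱ (subst (_< P) (*-identityʳ a) (^-monoʳ-< a (<⇒≤ 3≤a) 1<X)) P≤a) (n≢0⇒n>0 X≢0)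
    from-gap : (∃ λ u → P + u ≡ c ^ Z) → X ≡ 1 × Z ≡ 1
    from-gap (u , P+u≡) = by-u (∣2^⇒2^ (suc m₀ * y) u∣) (∣2^⇒2^ (suc m₀ * y) v∣)
      where
      b^y≡ : u * (u + 2 * P) ≡ 2 ^ (suc m₀ * y)
      b^y≡ = trans (sym (difference-of-squares {P} {b ^ y} {u} (trans eq (sym (cong₂ _*_ P+u≡ P+u≡))))) (b^≡ y)
      u∣ : u ∣ 2 ^ (suc m₀ * y)
      u∣ = subst (u ∣_) b^y≡ (m∣m*n (u + 2 * P))
      v∣ : u + 2 * P ∣ 2 ^ (suc m₀ * y)
      v∣ = subst (u + 2 * P ∣_) b^y≡ (n∣m*n u)
      odd-P+u : ¬ 2 ∣ P + u
      odd-P+u = subst (λ C → ¬ 2 ∣ C) (sym P+u≡) (odd-^ Z odd-c)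
      6≤v : 6 ≤ u + 2 * P
      6≤v = ≤-trans (*-monoʳ-≤ 2 3≤P) (m≤n+m (2 * P) u)
      4∣2^ : ∀ i → 4 ∣ 2 ^ suc (suc i)
      4∣2^ i = subst (4 ∣_) (*-assoc 2 2 (2 ^ i)) (m∣m*n (2 ^ i))
      -- Both u and u + 2P are powers of 2, their sum is 2 c ^ Z with c odd, and the second is at
      -- least 6. So u is even but not a multiple of 4, which leaves u = 2.
      by-u : (∃ λ i → u ≡ 2 ^ i) → (∃ λ j → u + 2 * P ≡ 2 ^ j) → X ≡ 1 × Z ≡ 1
      by-u (zero , u≡) (zero , v≡) = contradiction (≤-trans 6≤v (≤-reflexive v≡)) λ { (s≤s ()) }
      by-u (zero , u≡) (suc j , v≡) = contradiction (∣1⇒≡1 (subst (2 ∣_) u≡ 2∣u)) λ ()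
        where
        2∣u : 2 ∣ u
        2∣u = ∣m+n∣m⇒∣n (subst (2 ∣_) (+-comm u (2 * P)) (subst (2 ∣_) (sym v≡) (m∣m*n (2 ^ j)))) (m∣m*n P)
      by-u (suc zero , u≡) (zero , v≡) = contradiction (≤-trans 6≤v (≤-reflexive v≡)) λ { (s≤s ()) }
      by-u (suc zero , u≡) (suc j , v≡) = from-two (trans (cong (P +_) (sym u≡)) P+u≡) (j ,
        *-cancelˡ-≡ _ _ 2 (trans (ring P) (trans (cong (_+ 2 * P) (sym u≡)) v≡)))
        where
        ring : ∀ P → 2 * (P + 1) ≡ 2 + 2 * P
        ring = solve-∀
      by-u (suc (suc i) , u≡) (zero , v≡) = contradiction (≤-trans 6≤v (≤-reflexive v≡)) λ { (s≤s ()) }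
      by-u (suc (suc i) , u≡) (suc zero , v≡) = contradiction (≤-trans 6≤v (≤-reflexive v≡)) λ { (s≤s (s≤s ())) }
      by-u (suc (suc i) , u≡) (suc (suc j) , v≡) =
        contradiction (subst (4 ∣_) (sym v≡) (4∣2^ j)) (¬4∣both {P} odd-P+u (subst (4 ∣_) (sym u≡) (4∣2^ i)))

  primitive-exponents : 1 ≤ x → 1 ≤ y → 1 ≤ z → a ^ x + b ^ y ≡ c ^ z → x ≡ 2 × y ≡ 2 × z ≡ 2
  primitive-exponents {x} {y} {z} 1≤x 1≤y 1≤z eq with odd-or-even x | odd-or-even z
  ... | inj₂ (j , refl) | _ = ⊥-elim (odd-a-exponent 1 z j 1≤y (trans (cong (a ^ x +_) (*-identityʳ (b ^ y))) eq))
  ... | inj₁ (zero , refl) | _ = contradiction 1≤x λ ()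
  ... | inj₁ (suc j , refl) | inj₂ (h , refl) = ⊥-elim (odd-c-exponent {y} h (suc j) (s≤s z≤n) 1≤y eq)
  ... | inj₁ (X@(suc _) , refl) | inj₁ (Z , refl)
    with even-exponents {y} X Z (λ ()) (trans (cong (_+ b ^ y) (sym (^-square a X))) (trans eq (^-square c Z)))
  ... | refl , refl = refl , ^-injectiveʳ {b} (<⇒≤ (<⇒≤ 4≤b)) (+-cancelˡ-≡ (a ^ 2) _ _ (trans eq
          (trans (^2 c) (trans (sym pyth) (sym (cong₂ _+_ (^2 a) (^2 b))))))) , refl

  pythagorean-multiple : ∀ n → a * n * (a * n) + b * n * (b * n) ≡ c * n * (c * n)
  pythagorean-multiple n = trans (ring a b n) (trans (cong (_* (n * n)) pyth) (ring′ c n))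
    where
    ring : ∀ a b n → a * n * (a * n) + b * n * (b * n) ≡ (a * a + b * b) * (n * n)
    ring = solve-∀
    ring′ : ∀ c n → c * c * (n * n) ≡ c * n * (c * n)
    ring′ = solve-∀

  -- Assembly of the cases.

  multiple-exponents : ∀ n → n ≢ 0 → n ≢ 1 → 1 ≤ x → 1 ≤ y → 1 ≤ z →
                       (a * n) ^ x + (b * n) ^ y ≡ (c * n) ^ z → x ≡ 2 × y ≡ 2 × z ≡ 2
  multiple-exponents {x} {y} {z} n n≢0 n≢1 1≤x 1≤y 1≤z eq = by-order (<-cmp x z) (<-cmp y z)
    where
    instance
      n-nonZero : NonZero n
      n-nonZero = ≢-nonZero n≢0
    divided : ∀ w i j l → w + i ≡ x → w + j ≡ y → w + l ≡ z → a ^ x * n ^ i + b ^ y * n ^ j ≡ c ^ z * n ^ l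
    divided w i j l refl refl refl = divide-common-power a b c n w i j l eq
    dominated : x ≤ z → y ≤ z → x ≡ 2 × y ≡ 2 × z ≡ 2
    dominated x≤z y≤z = pythagorean-exponents (≤-trans (<⇒≤ 3≤a) (m≤m*n a n)) (≤-trans (<⇒≤ (<⇒≤ 4≤b)) (m≤m*n b n))
      (pythagorean-multiple n) 1≤x 1≤y x≤z y≤z eq
    by-order : Tri (x < z) (x ≡ z) (z < x) → Tri (y < z) (y ≡ z) (z < y) → x ≡ 2 × y ≡ 2 × z ≡ 2
    by-order (tri< x<z _ _) (tri< y<z _ _) = dominated (<⇒≤ x<z) (<⇒≤ y<z)
    by-order (tri< x<z _ _) (tri≈ _ y≡z _) = dominated (<⇒≤ x<z) (≤-reflexive y≡z)
    by-order (tri≈ _ x≡z _) (tri< y<z _ _) = dominated (≤-reflexive x≡z) (<⇒≤ y<z)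
    by-order (tri≈ _ x≡z _) (tri≈ _ y≡z _) = dominated (≤-reflexive x≡z) (≤-reflexive y≡z)
    by-order (tri> _ _ z<x) (tri> _ _ z<y) with <⇒∃suc z<x | <⇒∃suc z<y
    ... | i , x≡ | j , y≡ with i ≟ j | trans (divided z (suc i) (suc j) 0 x≡ y≡ (+-identityʳ z)) (*-identityʳ (c ^ z))
    ... | no i≢j | eq′ = ⊥-elim (no-z<min-distinct {y = y} i j i≢j n≢0 n≢1 z<x z<y eq′)
    ... | yes i≡j | eq′ = ⊥-elim (no-z<x≡y {n = n} i z<x
            (trans (cong₂ (λ y j → a ^ x * n ^ suc i + b ^ y * n ^ suc j) (trans (sym x≡) (trans (cong (λ i → z + suc i) i≡j) y≡)) i≡j) eq′))
    by-order (tri> _ _ z<x) (tri≈ _ refl _) with <⇒∃suc z<x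
    ... | i , x≡ = ⊥-elim (no-z≡y<x {N = n ^ suc i} 1≤y z<x
            (trans (cong (a ^ x * n ^ suc i +_) (sym (*-identityʳ (b ^ y))))
            (trans (divided y (suc i) 0 0 x≡ (+-identityʳ y) (+-identityʳ y)) (*-identityʳ (c ^ y)))))
    by-order (tri≈ _ refl _) (tri> _ _ z<y) with <⇒∃suc z<y
    ... | j , y≡ = ⊥-elim (no-z≡x<y {N = n ^ suc j} 1≤x z<y
            (trans (cong (_+ b ^ y * n ^ suc j) (sym (*-identityʳ (a ^ x))))
            (trans (divided x 0 (suc j) 0 (+-identityʳ x) y≡ (+-identityʳ x)) (*-identityʳ (c ^ x)))))
    by-order (tri> _ _ z<x) (tri< y<z _ _) with <⇒∃suc z<x | <⇒∃suc y<z
    ... | i , x≡ | l , z≡ = ⊥-elim (absurd n^∣b^y)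
      where
      -- The excess x - y is split as (z - y) + (x - z), so that n ^ (z - y) can be taken out of
      -- every term.
      w≡ : y + (suc l + suc i) ≡ x
      w≡ = trans (sym (+-assoc y (suc l) (suc i))) (trans (cong (_+ suc i) z≡) x≡)
      eq′ : a ^ x * n ^ (suc l + suc i) + b ^ y ≡ c ^ z * n ^ suc l
      eq′ = trans (cong (a ^ x * n ^ (suc l + suc i) +_) (sym (*-identityʳ (b ^ y))))
        (divided y (suc l + suc i) 0 (suc l) w≡ (+-identityʳ y) z≡)
      split : a ^ x * n ^ (suc l + suc i) ≡ a ^ x * n ^ suc i * n ^ suc l
      split = trans (cong (a ^ x *_) (trans (^-distribˡ-+-* n (suc l) (suc i)) (*-comm (n ^ suc l) _))) (sym (*-assoc (a ^ x) _ _))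
      n^∣b^y : n ^ suc l ∣ b ^ y
      n^∣b^y = ∣m+n∣m⇒∣n (subst (n ^ suc l ∣_) (sym eq′) (n∣m*n (c ^ z))) (subst (n ^ suc l ∣_) (sym split) (n∣m*n (a ^ x * n ^ suc i)))
      absurd : n ^ suc l ∣ b ^ y → ⊥
      absurd (divides t b^y≡) = no-y<z<x {y = y} {t = t} i l n≢1 1≤z z<x b^y≡ (*-cancelʳ-≡ _ _ (n ^ suc l) {{m^n≢0 n (suc l)}}
        (trans (*-distribʳ-+ (n ^ suc l) (a ^ x * n ^ suc i) t) (trans (cong₂ _+_ (sym split) (sym b^y≡)) eq′)))
    by-order (tri< x<z _ _) (tri> _ _ z<y) with <⇒∃suc z<y | <⇒∃suc x<z
    ... | j , y≡ | l , z≡ = ⊥-elim (absurd n^∣a^x)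
      where
      w≡ : x + (suc l + suc j) ≡ y
      w≡ = trans (sym (+-assoc x (suc l) (suc j))) (trans (cong (_+ suc j) z≡) y≡)
      eq′ : a ^ x + b ^ y * n ^ (suc l + suc j) ≡ c ^ z * n ^ suc l
      eq′ = trans (cong (_+ b ^ y * n ^ (suc l + suc j)) (sym (*-identityʳ (a ^ x))))
        (divided x 0 (suc l + suc j) (suc l) (+-identityʳ x) w≡ z≡)
      split : b ^ y * n ^ (suc l + suc j) ≡ b ^ y * n ^ suc j * n ^ suc l
      split = trans (cong (b ^ y *_) (trans (^-distribˡ-+-* n (suc l) (suc j)) (*-comm (n ^ suc l) _))) (sym (*-assoc (b ^ y) _ _))
      n^∣a^x : n ^ suc l ∣ a ^ x
      n^∣a^x = ∣m+n∣m⇒∣n (subst (n ^ suc l ∣_) (trans (sym eq′) (+-comm (a ^ x) _)) (n∣m*n (c ^ z)))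
        (subst (n ^ suc l ∣_) (sym split) (n∣m*n (b ^ y * n ^ suc j)))
      absurd : n ^ suc l ∣ a ^ x → ⊥
      absurd (divides t a^x≡) = no-x<z<y {t = t} j l n≢0 n≢1 1≤x x<z z<y a^x≡ (*-cancelʳ-≡ _ _ (n ^ suc l) {{m^n≢0 n (suc l)}}
        (trans (*-distribʳ-+ (n ^ suc l) t (b ^ y * n ^ suc j)) (trans (cong₂ _+_ (sym a^x≡) (sym split)) eq′)))

  exponents : ∀ n → 1 ≤ n → 1 ≤ x → 1 ≤ y → 1 ≤ z →
              (a * n) ^ x + (b * n) ^ y ≡ (c * n) ^ z → x ≡ 2 × y ≡ 2 × z ≡ 2
  exponents {x} {y} {z} 1 _ 1≤x 1≤y 1≤z eq = primitive-exponents 1≤x 1≤y 1≤z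
    (trans (sym (cong₂ (λ u v → u ^ x + v ^ y) (*-identityʳ a) (*-identityʳ b))) (trans eq (cong (_^ z) (*-identityʳ c))))
  exponents n@(suc (suc _)) _ = multiple-exponents n (λ ()) (λ ())

  solution : ∀ n → (a * n) ^ 2 + (b * n) ^ 2 ≡ (c * n) ^ 2
  solution n = trans (cong₂ _+_ (^2 (a * n)) (^2 (b * n))) (trans (pythagorean-multiple n) (sym (^2 (c * n))))

theorem1 : ∀ (k : ℕ) → k ≥ 1 → ∀ (n : ℕ) → n ≥ 1 →
    ∀ (x y z : ℕ) → x ≥ 1 → y ≥ 1 → z ≥ 1 →
    (((fermat k ∸ 2) * n) ^ x + (2 ^ (2 ^ (k ∸ 1) + 1) * n) ^ y ≡ (fermat k * n) ^ z)
    ⇔ ((x , y , z) ≡ (2 , 2 , 2))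
theorem1 (suc k) _ n 1≤n x y z 1≤x 1≤y 1≤z = mk⇔ to from
  where
  F = fermat (suc k)
  q = 2 ^ (2 ^ k)
  F≡ : F ≡ q * q + 1
  F≡ = cong (_+ 1) (^-square 2 (2 ^ k))
  2≤F : 2 ≤ F
  2≤F = +-monoˡ-≤ 1 (m^n>0 2 (2 ^ suc k))
  c≡ : F ∸ 2 + 2 ≡ F
  c≡ = m∸n+n≡m 2≤F
  b≡ : 2 ^ (2 ^ k + 1) ≡ 2 * q
  b≡ = cong (2 ^_) (+-comm (2 ^ k) 1)
  -- Only a + 1 = q² is passed on, so the truncated subtraction in F ∸ 2 stays outside the argument.
  open Triple k (F ∸ 2) (+-cancelʳ-≡ 1 _ _ (trans (+-assoc (F ∸ 2) 1 1) (trans c≡ F≡)))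
  to : ((F ∸ 2) * n) ^ x + (2 ^ (2 ^ k + 1) * n) ^ y ≡ (F * n) ^ z → (x , y , z) ≡ (2 , 2 , 2)
  to eq with exponents n 1≤n 1≤x 1≤y 1≤z (subst₂ (λ b c → ((F ∸ 2) * n) ^ x + (b * n) ^ y ≡ (c * n) ^ z) b≡ (sym c≡) eq)
  ... | refl , refl , refl = refl
  from : (x , y , z) ≡ (2 , 2 , 2) → ((F ∸ 2) * n) ^ x + (2 ^ (2 ^ k + 1) * n) ^ y ≡ (F * n) ^ z
  from refl = subst₂ (λ b c → ((F ∸ 2) * n) ^ 2 + (b * n) ^ 2 ≡ (c * n) ^ 2) (sym b≡) c≡ (solution n)
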